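{- Let $G$ be a finite connected simple graph. Then the connected subgraph arrangement $\mathcal{A}_G$ (with its defining forms considered over $\mathbb{R}$) is simplicial if and only if $G$ is a triangle (the cycle $C_3$) or a path graph.
   Context: For a finite simple graph $G=(N,E)$ with $N=\{1,\dots,n\}$ and $I\subseteq N$, $G[I]$ denotes the induced subgraph on $I$, and $H_I=\ker\big(\sum_{i\in I}x_i\big)$, where $x_1,\dots,x_n$ are the coordinate functions. The connected subgraph arrangement of $G$ is $\mathcal{A}_G=\{H_I:\emptyset\neq I\subseteq N,\ G[I]\text{ connected}\}$. An arrangement of hyperplanes in $\mathbb{R}^n$ is simplicial if every connected component of the complement of the union of its hyperplanes is an open simplicial cone. -}

module Defs where

open import Algebra.Bundles using (CommutativeRing)
import Algebra.Properties.Monoid.Sum as MonoidSum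
open import Data.Bool.Base using (if_then_else_)
open import Data.Fin.Base using (Fin; toℕ)
open import Data.Fin.Subset using (Subset; Nonempty) renaming (_∈_ to _∈ₛ_)
open import Data.Nat.Base using (ℕ; suc)
open import Data.Product.Base using (Σ; ∃; _×_; _,_; proj₁; proj₂)
open import Data.Sum.Base using (_⊎_; inj₁; inj₂)
open import Data.Vec.Base using (lookup)
open import Data.Vec.Functional using (Vector)
open import Function.Base using (_∘_)
open import Function.Bundles using (_↔_; _⇔_; Inverse)
open import Level using (0ℓ)
open import Relation.Binary.Construct.Closure.ReflexiveTransitive using (Star)
open import Relation.Binary.Core using (Rel)
open import Relation.Binary.Definitions using (Irreflexive; Symmetric)
open import Relation.Binary.PropositionalEquality.Core using (_≡_; _≢_; refl; ≢-sym)
open import Relation.Binary.Structures using (IsStrictTotalOrder)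
open import Relation.Nullary.Negation.Core using (¬_)
open import Relation.Unary using (Pred; _∈_; _⊆_; _≬_; _∩_; _∪_; ∁; ⋃; Satisfiable)

record Graph (V : Set) : Set₁ where
  field
    Adj     : Rel V 0ℓ
    symm    : Symmetric Adj
    irrefl  : Irreflexive _≡_ Adj

open Graph public

-- The graph with no vertices is not connected.
Connected : {V : Set} → Graph V → Set
Connected {V} G = V × (∀ u v → Star (Adj G) u v)

infix 8 _[_]

_[_] : {n : ℕ} → Graph (Fin n) → (I : Subset n) → Graph (Σ (Fin n) (_∈ₛ I))
G [ I ] = record
  { Adj    = λ u v → Adj G (proj₁ u) (proj₁ v)
  ; symm   = symm G
  ; irrefl = λ { refl → irrefl G refl }
  }

infix 4 _≅_

record _≅_ {V W : Set} (G : Graph V) (H : Graph W) : Set where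
  field
    vertices : V ↔ W
    adjacent : ∀ u v → Adj G u v ⇔ Adj H (Inverse.to vertices u) (Inverse.to vertices v)

-- C₃ = K₃: distinct vertices are adjacent.
triangle : Graph (Fin 3)
triangle = record
  { Adj    = _≢_
  ; symm   = ≢-sym
  ; irrefl = λ eq neq → neq eq
  }

path : (m : ℕ) → Graph (Fin m)
path m = record
  { Adj    = λ i j → suc (toℕ i) ≡ toℕ j ⊎ suc (toℕ j) ≡ toℕ i
  ; symm   = λ { (inj₁ p) → inj₂ p ; (inj₂ p) → inj₁ p }
  ; irrefl = λ { refl (inj₁ p) → noLoop _ p ; refl (inj₂ p) → noLoop _ p }
  }
  where
  noLoop : ∀ k → ¬ (suc k ≡ k)
  noLoop _ ()

IsTriangle : {V : Set} → Graph V → Set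
IsTriangle G = G ≅ triangle

IsPath : {V : Set} → Graph V → Set
IsPath G = ∃ λ m → G ≅ path m

-- The axioms characterising ℝ up to isomorphism.  They cannot be satisfied
-- without classical logic (the order is decidable and every inhabited bounded
-- set has a least upper bound), but given excluded middle the usual
-- constructions, e.g. decidable Dedekind cuts ℚ → Bool, provide a model.
record CompleteOrderedField : Set₁ where
  field
    commutativeRing : CommutativeRing 0ℓ 0ℓ

  open CommutativeRing commutativeRing public

  infix 4 _<_ _≤_

  field
    _<_                : Rel Carrier 0ℓ
    isStrictTotalOrder : IsStrictTotalOrder _≈_ _<_
    0≉1                : ¬ (0# ≈ 1#)
    inverse            : ∀ x → ¬ (x ≈ 0#) → ∃ λ y → x * y ≈ 1#
    +-monoˡ-<          : ∀ {x y} z → x < y → x + z < y + z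
    *-pos              : ∀ {x y} → 0# < x → 0# < y → 0# < x * y

  _≤_ : Rel Carrier 0ℓ
  x ≤ y = x < y ⊎ x ≈ y

  UpperBound : Pred Carrier 0ℓ → Pred Carrier 0ℓ
  UpperBound S b = ∀ x → x ∈ S → x ≤ b

  field
    complete : ∀ (S : Pred Carrier 0ℓ) → Satisfiable S → Satisfiable (UpperBound S) →
               ∃ λ s → s ∈ UpperBound S × (∀ b → b ∈ UpperBound S → s ≤ b)

module _ (ℝ : CompleteOrderedField) where
  open CompleteOrderedField ℝ
  open MonoidSum +-monoid using (sum)

  Point : ℕ → Set
  Point n = Vector Carrier n

  module _ {n : ℕ} where

    -- Open boxes form a basis of the usual topology of ℝⁿ.
    Open : Pred (Point n) 0ℓ → Set
    Open U = ∀ x → x ∈ U → ∃ λ ε → 0# < ε ×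
             (∀ y → (∀ i → x i - ε < y i × y i < x i + ε) → y ∈ U)

    TopConnected : Pred (Point n) 0ℓ → Set₁
    TopConnected S = Satisfiable S ×
      (∀ (U V : Pred (Point n) 0ℓ) → Open U → Open V →
       S ⊆ U ∪ V → S ≬ U → S ≬ V → S ≬ (U ∩ V))

    IsComponent : Pred (Point n) 0ℓ → Pred (Point n) 0ℓ → Set₁
    IsComponent M C = C ⊆ M × TopConnected C ×
      (∀ (D : Pred (Point n) 0ℓ) → TopConnected D → C ⊆ D → D ⊆ M → D ⊆ C)

    combination : {k : ℕ} → Vector Carrier k → Vector (Point n) k → Point n
    combination c v j = sum (λ i → c i * v i j)

    LinearlyIndependent : {k : ℕ} → Vector (Point n) k → Set
    LinearlyIndependent v = ∀ c → (∀ j → combination c v j ≈ 0#) → ∀ i → c i ≈ 0#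

    -- The set of strictly positive combinations of n linearly independent
    -- vectors, i.e. of a basis of ℝⁿ.
    IsOpenSimplicialCone : Pred (Point n) 0ℓ → Set
    IsOpenSimplicialCone C = ∃ λ (v : Vector (Point n) n) → LinearlyIndependent v ×
      (∀ x → x ∈ C ⇔ (∃ λ c → (∀ i → 0# < c i) × (∀ j → x j ≈ combination c v j)))

    -- The arrangement is given as a family of hyperplanes; only the union of
    -- its members matters, so repetitions are harmless.
    Simplicial : {Index : Set} → (Index → Pred (Point n) 0ℓ) → Set₁
    Simplicial {Index} 𝒜 = ∀ (C : Pred (Point n) 0ℓ) →
      IsComponent (∁ (⋃ Index 𝒜)) C → IsOpenSimplicialCone C

    ker : (Point n → Carrier) → Pred (Point n) 0ℓ
    ker f x = f x ≈ 0#

    coordinateSum : Subset n → Point n → Carrier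
    coordinateSum I x = sum (λ i → if lookup I i then x i else 0#)

    connectedSubgraphArrangement :
      (G : Graph (Fin n)) →
      (∃ λ (I : Subset n) → Nonempty I × Connected (G [ I ])) → Pred (Point n) 0ℓ
    connectedSubgraphArrangement G = ker ∘ coordinateSum ∘ proj₁

{-# OPTIONS --safe #-}
-- The complement of the arrangement decomposes into the cells on which no form x_I changes
-- sign: they are convex, hence connected, and they are separated by open half-spaces.
--
-- For a path, the forms are the differences of the prefix sums of the coordinates, so a cell
-- is given by an ordering of these sums and its walls are the differences of neighbours. For
-- the triangle, the 32 cells are listed together with the bases dual to their walls.
--
-- Conversely, the closure of a simplicial cone is a lattice cone, so a + b = c + d has a common
-- refinement in it. This fails if the closure of a cell contains, near a generic point of some
-- flat, a quadrilateral whose diagonals are a, b and c, d. Such a flat exists if there are disjoint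
-- A₁, …, A₄ with A₁ ∪ A₂, A₂ ∪ A₃, A₃ ∪ A₄, A₄ ∪ A₁ connected (for example, four arcs of a cycle),
-- since x_{A₁∪A₂} + x_{A₃∪A₄} = x_{A₂∪A₃} + x_{A₄∪A₁}; or a vertex v with neighbours u₁, u₂, u₃ of
-- which u₁, u₂ are not adjacent, since x_{vu₁u₂} + x_{vu₃} = x_v + x_{vu₁u₂u₃} while {u₁ , u₂} gives
-- no hyperplane. A longest path of G shows that otherwise G is a path or a triangle.
module Submission where

open import Algebra.Bundles using (CommutativeRing)
import Algebra.Properties.Ring as RingProperties
import Algebra.Properties.Semiring.Sum as SemiringSum
import Algebra.Solver.Ring as RingSolver
open import Algebra.Solver.Ring.AlmostCommutativeRing using (AlmostCommutativeRing; fromCommutativeRing; _-Raw-AlmostCommutative⟶_)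
open import Axiom.ExcludedMiddle using (ExcludedMiddle)
open import Data.Bool.Base using (Bool; true; false; if_then_else_)
import Data.Bool.Properties as Bool
open import Data.Empty using (⊥; ⊥-elim)
open import Data.Fin.Base using (Fin; zero; suc; inject₁; fromℕ; toℕ; fromℕ<; punchIn)
open import Data.Fin.Induction using (<-weakInduction; >-weakInduction)
open import Data.Fin.Patterns using (0F; 1F; 2F; 3F; 4F; 5F; 6F)
open import Data.Fin.Permutation as Perm using (Permutation′; _⟨$⟩ʳ_; _⟨$⟩ˡ_; ↔⇒≡)
import Data.Fin.Properties as Fin
open import Data.Fin.Subset using (Subset; Nonempty; inside; outside)
open import Data.Fin.Subset.Properties using (anySubset?)
open import Data.Integer.Base as ℤ using (ℤ; +_; -[1+_])
import Data.Integer.Properties as ℤ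
open import Data.List.Base as List using (List; []; _∷_)
open import Data.List.Membership.Propositional using (_∈_)
open import Data.List.Membership.Propositional.Properties using (∈-++⁺ˡ; ∈-++⁺ʳ; ∈-map⁺; ∈-allFin)
open import Data.List.Relation.Unary.All as All using (All)
open import Data.List.Relation.Unary.Any as Any using (here; there; Any)
open import Data.Maybe.Base using (Maybe; just; nothing; maybe′)
open import Data.Nat.Base as ℕ using (ℕ; zero; suc; _∸_; z≤n; s≤s)
import Data.Nat.Properties as ℕ
open import Data.Product.Base using (∃; _×_; _,_; proj₁; proj₂; Σ)
open import Data.Sum.Base as Sum using (_⊎_; inj₁; inj₂; [_,_]′)
open import Data.Vec.Base using (lookup; Vec; []; _∷_; tabulate)
import Data.Vec.Base as Vec
open import Data.Vec.Properties using (lookup∘tabulate; lookup⇒[]=; []=⇒lookup; tabulate∘lookup; tabulate-cong)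
import Data.Vec.Properties as Vec
open import Data.Vec.Properties.WithK using ([]=-irrelevant)
open import Defs
open import Function.Base using (_∘_)
open import Function.Bundles using (_⇔_; mk⇔; Equivalence; _↔_; mk↔ₛ′; Inverse)
open import Level using (0ℓ)
open import Relation.Binary.Construct.Closure.ReflexiveTransitive using (Star; ε; _◅_; _◅◅_; reverse)
open import Relation.Binary.Definitions using (tri<; tri≈; tri>)
open import Relation.Binary.PropositionalEquality.Core as ≡ using (_≡_; _≢_)
import Relation.Binary.Reasoning.Setoid as SetoidReasoning
open import Relation.Binary.Structures using (IsStrictTotalOrder)
open import Relation.Nullary using (¬_; Dec; yes; no; contradiction; does)
open import Relation.Nullary.Decidable using (_×-dec_; _⊎-dec_; ¬?; False; toWitnessFalse; dec-true; decidable-stable)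
open import Relation.Unary using (Pred; ⋃; ∁)

-- Ordered fields

-- Outside a few vertices `G` is arbitrary, so it is mostly unknown which sets are connected, and
-- the cells cannot be listed. Near a generic point of a flat only the hyperplanes containing the
-- flat matter, and the flat is chosen so that these belong to unions of three or four classes of
-- vertices. The connectedness of such a union is then known or immaterial. For four arcs of a cycle
-- the weights 1, -1, 1, -1 are adjoined to the flat: they discard the unions of opposite arcs,
-- whose connectedness depends on chords. For a vertex with three neighbours, the only form that
-- would cut the quadrilateral is that of u₁, u₂; its hyperplane runs along a diagonal, and
-- non-adjacency removes it. What remains is a sign check over at most sixteen subsets, independent
-- of `n`. Failure to be simplicial is derived from the generators in the definition, by comparing
-- coordinates, so the facets of a cell are never determined. The arrangement of a path is a braid
-- arrangement in disguise, which is why sorting appears.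

module IntegerCoefficients (R : CommutativeRing 0ℓ 0ℓ) where
  open CommutativeRing R
  open RingProperties ring
  open SetoidReasoning setoid

  -- The separate clause for one makes `fromℤ (+ 1)` reduce to `1#`, so that equations obtained from
  -- `solve` contain `1#` and not `1# + 0#`.
  natural : ℕ → Carrier
  natural zero          = 0#
  natural (suc zero)    = 1#
  natural (suc (suc n)) = 1# + natural (suc n)

  fromℤ : ℤ → Carrier
  fromℤ (+ n)      = natural n
  fromℤ (-[1+ n ]) = - natural (suc n)

  natural-suc : ∀ n → natural (suc n) ≈ 1# + natural n
  natural-suc zero    = sym (+-identityʳ 1#)
  natural-suc (suc n) = refl

  natural-+ : ∀ m n → natural (m ℕ.+ n) ≈ natural m + natural n
  natural-+ zero    n = sym (+-identityˡ _)
  natural-+ (suc m) n = begin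
    natural (suc (m ℕ.+ n))      ≈⟨ natural-suc (m ℕ.+ n) ⟩
    1# + natural (m ℕ.+ n)       ≈⟨ +-congˡ (natural-+ m n) ⟩
    1# + (natural m + natural n)   ≈⟨ +-assoc _ _ _ ⟨
    1# + natural m + natural n     ≈⟨ +-congʳ (natural-suc m) ⟨
    natural (suc m) + natural n    ∎

  natural-* : ∀ m n → natural (m ℕ.* n) ≈ natural m * natural n
  natural-* zero    n = sym (zeroˡ _)
  natural-* (suc m) n = begin
    natural (n ℕ.+ m ℕ.* n)              ≈⟨ natural-+ n (m ℕ.* n) ⟩
    natural n + natural (m ℕ.* n)          ≈⟨ +-cong (sym (*-identityˡ _)) (natural-* m n) ⟩
    1# * natural n + natural m * natural n   ≈⟨ distribʳ _ _ _ ⟨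
    (1# + natural m) * natural n           ≈⟨ *-congʳ (natural-suc m) ⟨
    natural (suc m) * natural n            ∎

  fromℤ-neg : ∀ i → fromℤ (ℤ.- i) ≈ - fromℤ i
  fromℤ-neg (+ zero)   = sym -0#≈0#
  fromℤ-neg (+ suc n)  = refl
  fromℤ-neg (-[1+ n ]) = sym (-‿involutive _)

  fromℤ-⊖ : ∀ m n → fromℤ (m ℤ.⊖ n) ≈ natural m - natural n
  fromℤ-⊖ m zero = trans (reflexive (≡.cong fromℤ (ℤ.⊖-≥ (ℕ.z≤n {m})))) (sym (trans (+-congˡ -0#≈0#) (+-identityʳ _)))
  fromℤ-⊖ zero    (suc n) = sym (+-identityˡ _)
  fromℤ-⊖ (suc m) (suc n) = begin
    fromℤ (suc m ℤ.⊖ suc n)              ≈⟨ reflexive (≡.cong fromℤ (ℤ.[1+m]⊖[1+n]≡m⊖n m n)) ⟩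
    fromℤ (m ℤ.⊖ n)                      ≈⟨ fromℤ-⊖ m n ⟩
    natural m - natural n                    ≈⟨ +-congʳ (+-identityˡ _) ⟨
    0# + natural m - natural n               ≈⟨ +-congʳ (+-congʳ (-‿inverseˡ 1#)) ⟨
    - 1# + 1# + natural m - natural n        ≈⟨ +-congʳ (+-assoc _ _ _) ⟩
    - 1# + (1# + natural m) - natural n      ≈⟨ +-congʳ (+-comm _ _) ⟩
    1# + natural m + - 1# - natural n        ≈⟨ +-assoc _ _ _ ⟩
    1# + natural m + (- 1# - natural n)      ≈⟨ +-congˡ (-‿+-comm _ _) ⟩
    1# + natural m - (1# + natural n)        ≈⟨ +-cong (natural-suc m) (-‿cong (natural-suc n)) ⟨
    natural (suc m) - natural (suc n)        ∎

  fromℤ-+ : ∀ i j → fromℤ (i ℤ.+ j) ≈ fromℤ i + fromℤ j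
  fromℤ-+ (+ m)      (+ n)      = natural-+ m n
  fromℤ-+ (+ m)      (-[1+ n ]) = fromℤ-⊖ m (suc n)
  fromℤ-+ (-[1+ m ]) (+ n)      = trans (fromℤ-⊖ n (suc m)) (+-comm _ _)
  fromℤ-+ (-[1+ m ]) (-[1+ n ]) = begin
    - (1# + natural (suc (m ℕ.+ n)))     ≈⟨ -‿cong (+-congˡ (natural-+ (suc m) n)) ⟩
    - (1# + (natural (suc m) + natural n)) ≈⟨ -‿cong (trans (sym (+-assoc _ _ _)) (trans (+-congʳ (+-comm _ _)) (+-assoc _ _ _))) ⟩
    - (natural (suc m) + (1# + natural n)) ≈⟨ -‿cong (+-congˡ (natural-suc n)) ⟨
    - (natural (suc m) + natural (suc n))  ≈⟨ -‿+-comm _ _ ⟨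
    - natural (suc m) - natural (suc n)    ∎

  fromℤ-*-ℕ : ∀ m j → fromℤ (+ m ℤ.* j) ≈ natural m * fromℤ j
  fromℤ-*-ℕ m (+ n)      = trans (reflexive (≡.cong fromℤ (≡.sym (ℤ.pos-* m n)))) (natural-* m n)
  fromℤ-*-ℕ m (-[1+ n ]) = begin
    fromℤ (+ m ℤ.* (ℤ.- (+ suc n)))   ≈⟨ reflexive (≡.cong fromℤ (ℤ.neg-distribʳ-* (+ m) (+ suc n))) ⟨
    fromℤ (ℤ.- (+ m ℤ.* + suc n))     ≈⟨ fromℤ-neg (+ m ℤ.* + suc n) ⟩
    - fromℤ (+ m ℤ.* + suc n)         ≈⟨ -‿cong (fromℤ-*-ℕ m (+ suc n)) ⟩
    - (natural m * natural (suc n))       ≈⟨ -‿distribʳ-* _ _ ⟩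
    natural m * - natural (suc n)         ∎

  fromℤ-* : ∀ i j → fromℤ (i ℤ.* j) ≈ fromℤ i * fromℤ j
  fromℤ-* (+ m)      j = fromℤ-*-ℕ m j
  fromℤ-* (-[1+ m ]) j = begin
    fromℤ (ℤ.- (+ suc m) ℤ.* j)     ≈⟨ reflexive (≡.cong fromℤ (ℤ.neg-distribˡ-* (+ suc m) j)) ⟨
    fromℤ (ℤ.- (+ suc m ℤ.* j))     ≈⟨ fromℤ-neg (+ suc m ℤ.* j) ⟩
    - fromℤ (+ suc m ℤ.* j)         ≈⟨ -‿cong (fromℤ-*-ℕ (suc m) j) ⟩
    - (natural (suc m) * fromℤ j)     ≈⟨ -‿distribˡ-* _ _ ⟩
    - natural (suc m) * fromℤ j       ∎

  private
    target : AlmostCommutativeRing 0ℓ 0ℓ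
    target = fromCommutativeRing R

    morphism : ℤ.+-*-rawRing -Raw-AlmostCommutative⟶ target
    morphism = record
      { ⟦_⟧    = fromℤ
      ; +-homo = fromℤ-+
      ; *-homo = fromℤ-*
      ; -‿homo = fromℤ-neg
      ; 0-homo = refl
      ; 1-homo = refl
      }

    -- Integer coefficients are compared by evaluation; equality in the abstract field would not
    -- compute.
    equal? : ∀ i j → Maybe (fromℤ i ≈ fromℤ j)
    equal? i j with i ℤ.≟ j
    ... | yes i≡j = just (reflexive (≡.cong fromℤ i≡j))
    ... | no  _   = nothing

  open RingSolver ℤ.+-*-rawRing target morphism equal? public
    using (Polynomial; solve; _:=_; _:+_; _:*_; _:-_; :-_; con)

module OrderedField (ℝ : CompleteOrderedField) where
  open CompleteOrderedField ℝ public hiding (zero)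
  open IntegerCoefficients commutativeRing public
    using (Polynomial; solve; _:=_; _:+_; _:*_; _:-_; :-_; con; fromℤ; fromℤ-+; fromℤ-neg)
  open IsStrictTotalOrder isStrictTotalOrder public
    using (compare; <-resp-≈)
    renaming (irrefl to <-irrefl; asym to <-asym; trans to <-trans)

  :0 :1 : ∀ {n} → Polynomial n
  :0 = con (+ 0)
  :1 = con (+ 1)

  <-respʳ : ∀ {x y z} → y ≈ z → x < y → x < z
  <-respʳ = proj₁ <-resp-≈

  <-respˡ : ∀ {x y z} → x ≈ y → x < z → y < z
  <-respˡ = proj₂ <-resp-≈

  ≤-respʳ : ∀ {x y z} → y ≈ z → x ≤ y → x ≤ z
  ≤-respʳ y≈z (inj₁ x<y) = inj₁ (<-respʳ y≈z x<y)
  ≤-respʳ y≈z (inj₂ x≈y) = inj₂ (trans x≈y y≈z)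

  ≮⇒≥ : ∀ {x y} → ¬ x < y → y ≤ x
  ≮⇒≥ {x} {y} x≮y with compare x y
  ... | tri< x<y _ _ = contradiction x<y x≮y
  ... | tri≈ _ x≈y _ = inj₂ (sym x≈y)
  ... | tri> _ _ y<x = inj₁ y<x

  <⇒≱ : ∀ {x y} → x < y → ¬ y ≤ x
  <⇒≱ x<y (inj₁ y<x) = <-asym x<y y<x
  <⇒≱ x<y (inj₂ y≈x) = <-irrefl (sym y≈x) x<y

  <⇒≉ : ∀ {x y} → x < y → ¬ x ≈ y
  <⇒≉ x<y x≈y = <-irrefl x≈y x<y

  <-≤-trans : ∀ {x y z} → x < y → y ≤ z → x < z
  <-≤-trans x<y (inj₁ y<z) = <-trans x<y y<z
  <-≤-trans x<y (inj₂ y≈z) = <-respʳ y≈z x<y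

  ≤-refl : ∀ {x} → x ≤ x
  ≤-refl = inj₂ refl

  0<y-x : ∀ {x y} → x < y → 0# < y - x
  0<y-x {x} x<y = <-respˡ (-‿inverseʳ x) (+-monoˡ-< (- x) x<y)

  0<y-x⇒x<y : ∀ {x y} → 0# < y - x → x < y
  0<y-x⇒x<y {x} {y} p = <-respˡ (+-identityˡ x)
    (<-respʳ (solve 2 (λ x y → y :- x :+ x := y) refl x y) (+-monoˡ-< x p))

  <0⇒0<- : ∀ {x} → x < 0# → 0# < - x
  <0⇒0<- x<0 = <-respʳ (+-identityˡ _) (0<y-x x<0)

  0<-⇒<0 : ∀ {x} → 0# < - x → x < 0#
  0<-⇒<0 p = 0<y-x⇒x<y (<-respʳ (sym (+-identityˡ _)) p)

  0<+ : ∀ {x y} → 0# < x → 0# < y → 0# < x + y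
  0<+ {x} {y} 0<x 0<y = <-trans (<-respʳ (sym (+-identityˡ y)) 0<y) (+-monoˡ-< y 0<x)

  0<+≤ : ∀ {x y} → 0# < x → 0# ≤ y → 0# < x + y
  0<+≤ 0<x (inj₁ 0<y) = 0<+ 0<x 0<y
  0<+≤ 0<x (inj₂ 0≈y) = <-respʳ (trans (sym (+-identityʳ _)) (+-congˡ 0≈y)) 0<x

  0≤+ : ∀ {x y} → 0# ≤ x → 0# ≤ y → 0# ≤ x + y
  0≤+ (inj₁ 0<x) 0≤y = inj₁ (0<+≤ 0<x 0≤y)
  0≤+ (inj₂ 0≈x) 0≤y = ≤-respʳ (trans (sym (+-identityˡ _)) (+-congʳ 0≈x)) 0≤y

  0≤* : ∀ {x y} → 0# ≤ x → 0# ≤ y → 0# ≤ x * y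
  0≤* (inj₁ 0<x) (inj₁ 0<y) = inj₁ (*-pos 0<x 0<y)
  0≤* {x} (inj₁ _) (inj₂ 0≈y) = inj₂ (trans (sym (zeroʳ x)) (*-congˡ 0≈y))
  0≤* {x} {y} (inj₂ 0≈x) _ = inj₂ (trans (sym (zeroˡ y)) (*-congʳ 0≈x))

  0<neg*neg : ∀ {x y} → x < 0# → y < 0# → 0# < x * y
  0<neg*neg {x} {y} x<0 y<0 =
    <-respʳ (solve 2 (λ x y → (:- x) :* (:- y) := x :* y) refl x y) (*-pos (<0⇒0<- x<0) (<0⇒0<- y<0))

  pos*neg<0 : ∀ {x y} → 0# < x → y < 0# → x * y < 0#
  pos*neg<0 {x} {y} 0<x y<0 = 0<-⇒<0
    (<-respʳ (solve 2 (λ x y → x :* (:- y) := :- (x :* y)) refl x y) (*-pos 0<x (<0⇒0<- y<0)))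

  0<*⇒≉0ˡ : ∀ {x y} → 0# < x * y → ¬ x ≈ 0#
  0<*⇒≉0ˡ {x} {y} p x≈0 = <-irrefl (sym (trans (*-congʳ x≈0) (zeroˡ y))) p

  0<*⇒≉0ʳ : ∀ {x y} → 0# < x * y → ¬ y ≈ 0#
  0<*⇒≉0ʳ {x} {y} p y≈0 = <-irrefl (sym (trans (*-congˡ y≈0) (zeroʳ x))) p

  0<*-cancelˡ : ∀ {x y} → 0# < x → 0# < x * y → 0# < y
  0<*-cancelˡ {x} {y} 0<x 0<xy with compare 0# y
  ... | tri< 0<y _ _ = 0<y
  ... | tri≈ _ 0≈y _ = contradiction (sym 0≈y) (0<*⇒≉0ʳ 0<xy)
  ... | tri> _ _ y<0 = contradiction (pos*neg<0 0<x y<0) (<-asym 0<xy)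

  0<x*x : ∀ {x} → ¬ x ≈ 0# → 0# < x * x
  0<x*x {x} x≉0 with compare 0# x
  ... | tri< 0<x _ _ = *-pos 0<x 0<x
  ... | tri≈ _ 0≈x _ = contradiction (sym 0≈x) x≉0
  ... | tri> _ _ x<0 = 0<neg*neg x<0 x<0

  0<1 : 0# < 1#
  0<1 = <-respʳ (*-identityˡ 1#) (0<x*x (0≉1 ∘ sym))

  x*y≉0 : ∀ {x y} → ¬ x ≈ 0# → ¬ y ≈ 0# → ¬ x * y ≈ 0#
  x*y≉0 {x} {y} x≉0 y≉0 xy≈0 with z , yz≈1 ← inverse y y≉0 = x≉0 (begin
    x            ≈⟨ *-identityʳ x ⟨
    x * 1#       ≈⟨ *-congˡ yz≈1 ⟨
    x * (y * z)  ≈⟨ *-assoc x y z ⟨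
    x * y * z    ≈⟨ *-congʳ xy≈0 ⟩
    0# * z       ≈⟨ zeroˡ z ⟩
    0#           ∎)
    where open SetoidReasoning setoid

  -- The product of the hypotheses is the positive square `s * s` times `x * y`.
  sign-agree : ∀ {s x y} → 0# < s * x → 0# < s * y → 0# < x * y
  sign-agree {s} {x} {y} sx sy = 0<*-cancelˡ (0<x*x (0<*⇒≉0ˡ sx))
    (<-respʳ (solve 3 (λ s x y → s :* x :* (s :* y) := s :* s :* (x :* y)) refl s x y) (*-pos sx sy))

  sign-agree-≤ : ∀ {s x y} → 0# < s * x → 0# ≤ s * y → 0# ≤ x * y
  sign-agree-≤ {s} {x} {y} sx (inj₁ sy) = inj₁ (sign-agree {s} sx sy)
  sign-agree-≤ {s} {x} {y} sx (inj₂ 0≈sy) = inj₂ (sym (trans (*-congˡ y≈0) (zeroʳ x)))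
    where
    y≈0 : y ≈ 0#
    y≈0 with compare y 0#
    ... | tri< _ y≉0 _ = contradiction (sym 0≈sy) (x*y≉0 (0<*⇒≉0ˡ sx) y≉0)
    ... | tri≈ _ y≈0 _ = y≈0
    ... | tri> _ y≉0 _ = contradiction (sym 0≈sy) (x*y≉0 (0<*⇒≉0ˡ sx) y≉0)

  0<inverse : ∀ {x} (0<x : 0# < x) → 0# < proj₁ (inverse x (<⇒≉ 0<x ∘ sym))
  0<inverse {x} 0<x = 0<*-cancelˡ 0<x (<-respʳ (sym (proj₂ (inverse x (<⇒≉ 0<x ∘ sym)))) 0<1)

  fromℤ-pos : ∀ {i} → + 0 ℤ.< i → 0# < fromℤ i
  fromℤ-pos {+ suc n} _ = natural-pos n
    where
    natural-pos : ∀ n → 0# < fromℤ (+ suc n)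
    natural-pos zero    = 0<1
    natural-pos (suc n) = 0<+ 0<1 (natural-pos n)
  fromℤ-pos {+ zero} (ℤ.+<+ ())

  fromℤ-nonneg : ∀ {i} → + 0 ℤ.≤ i → 0# ≤ fromℤ i
  fromℤ-nonneg {+ zero}  _ = inj₂ refl
  fromℤ-nonneg {+ suc n} _ = inj₁ (fromℤ-pos {+ suc n} (ℤ.+<+ (ℕ.s≤s ℕ.z≤n)))

  fromℤ≈0⇒≡0 : ∀ {i} → fromℤ i ≈ 0# → i ≡ + 0
  fromℤ≈0⇒≡0 {+ zero}   _ = ≡.refl
  fromℤ≈0⇒≡0 {+ suc n}  e = contradiction (sym e) (<⇒≉ (fromℤ-pos {+ suc n} (ℤ.+<+ (ℕ.s≤s ℕ.z≤n))))
  fromℤ≈0⇒≡0 { -[1+ n ]} e = contradiction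
    (sym (trans (trans (sym (+-identityʳ _)) (+-congˡ (sym e))) (-‿inverseʳ (fromℤ (+ suc n)))))
    (<⇒≉ (fromℤ-pos {+ suc n} (ℤ.+<+ (ℕ.s≤s ℕ.z≤n))))

-- Components of the complement of an arrangement

module Estimates (ℝ : CompleteOrderedField) where
  open OrderedField ℝ
  open SemiringSum semiring using (sum)

  half : ∀ {x} → 0# < x → ∃ λ h → 0# < h × h + h ≈ x
  half {x} 0<x = x * i , *-pos 0<x (0<inverse 0<2) ,
    trans (solve 2 (λ x i → x :* i :+ x :* i := x :* ((:1 :+ :1) :* i)) refl x i)
          (trans (*-congˡ (proj₂ inv)) (*-identityʳ x))
    where
    0<2 = 0<+ 0<1 0<1
    inv = inverse (1# + 1#) (<⇒≉ 0<2 ∘ sym)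
    i = proj₁ inv

  h<h+h : ∀ {h x} → 0# < h → h + h ≈ x → h < x
  h<h+h {h} 0<h eq = 0<y-x⇒x<y (<-respʳ (trans (solve 1 (λ h → h := h :+ h :- h) refl h) (+-congʳ eq)) 0<h)

  lower : ∀ {x y} → 0# < x → 0# < y → ∃ λ z → 0# < z × z ≤ x × z ≤ y
  lower {x} {y} 0<x 0<y with compare x y
  ... | tri< x<y _ _ = x , 0<x , ≤-refl , inj₁ x<y
  ... | tri≈ _ x≈y _ = x , 0<x , ≤-refl , inj₂ x≈y
  ... | tri> _ _ y<x = y , 0<y , inj₁ y<x , ≤-refl

  infix 4 _within_

  -- Encodes |x| < e without an absolute value, as positivity of two terms that the ring solver can
  -- rearrange.
  _within_ : Carrier → Carrier → Set
  x within e = 0# < e - x × 0# < e + x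

  within-resp : ∀ {x y e} → x ≈ y → x within e → y within e
  within-resp x≈y (p , q) = <-respʳ (+-congˡ (-‿cong x≈y)) p , <-respʳ (+-congˡ x≈y) q

  within-mono : ∀ {x e e′} → e ≤ e′ → x within e → x within e′
  within-mono {x} {e} {e′} (inj₂ e≈e′) (p , q) = <-respʳ (+-congʳ e≈e′) p , <-respʳ (+-congʳ e≈e′) q
  within-mono {x} {e} {e′} (inj₁ e<e′) (p , q) =
    <-respʳ (solve 3 (λ x e e′ → (e :- x) :+ (e′ :- e) := e′ :- x) refl x e e′) (0<+ p (0<y-x e<e′)) ,
    <-respʳ (solve 3 (λ x e e′ → (e :+ x) :+ (e′ :- e) := e′ :+ x) refl x e e′) (0<+ q (0<y-x e<e′))

  0-within : ∀ {e} → 0# < e → 0# within e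
  0-within {e} 0<e =
    <-respʳ (solve 1 (λ e → e := e :- :0) refl e) 0<e , <-respʳ (sym (+-identityʳ e)) 0<e

  within-+ : ∀ {x y d e} → x within d → y within e → x + y within d + e
  within-+ {x} {y} {d} {e} (p , q) (r , s) =
    <-respʳ (solve 4 (λ x y d e → d :- x :+ (e :- y) := d :+ e :- (x :+ y)) refl x y d e) (0<+ p r) ,
    <-respʳ (solve 4 (λ x y d e → d :+ x :+ (e :+ y) := d :+ e :+ (x :+ y)) refl x y d e) (0<+ q s)

  -- Both claims come doubled: (d - x)(e + y) + (d + x)(e - y) = 2(de - xy), and similarly for de +
  -- xy, with positive factors on the left.
  within-* : ∀ {x y d e} → x within d → y within e → x * y within d * e
  within-* {x} {y} {d} {e} (p , q) (r , s) =
    0<*-cancelˡ (0<+ 0<1 0<1) (<-respʳ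
      (solve 4 (λ x y d e → (d :- x) :* (e :+ y) :+ (d :+ x) :* (e :- y) := (:1 :+ :1) :* (d :* e :- x :* y))
        refl x y d e)
      (0<+ (*-pos p s) (*-pos q r))) ,
    0<*-cancelˡ (0<+ 0<1 0<1) (<-respʳ
      (solve 4 (λ x y d e → (d :+ x) :* (e :+ y) :+ (d :- x) :* (e :- y) := (:1 :+ :1) :* (d :* e :+ x :* y))
        refl x y d e)
      (0<+ (*-pos q s) (*-pos p r)))

  within-bound : ∀ x → ∃ λ e → 0# < e × x within e
  within-bound x with compare 0# x
  ... | tri< 0<x _ _ = x + 1# , 0<+ 0<x 0<1 ,
    <-respʳ (solve 1 (λ x → :1 := x :+ :1 :- x) refl x) 0<1 , 0<+ (0<+ 0<x 0<1) 0<x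
  ... | tri≈ _ 0≈x _ = 1# , 0<1 , within-resp 0≈x (0-within 0<1)
  ... | tri> _ _ x<0 = 1# - x , 0<+ 0<1 (<0⇒0<- x<0) ,
    0<+ (0<+ 0<1 (<0⇒0<- x<0)) (<0⇒0<- x<0) , <-respʳ (solve 1 (λ x → :1 := :1 :- x :+ x) refl x) 0<1

  within-common-bound : ∀ {n} (x : Fin n → Carrier) → ∃ λ e → 0# < e × (∀ i → x i within e)
  within-common-bound {zero}  x = 1# , 0<1 , λ ()
  within-common-bound {suc n} x
    with d , 0<d , xd ← within-bound (x zero) | e , 0<e , xe ← within-common-bound (x ∘ suc)
    = d + e , 0<+ 0<d 0<e , λ
      { zero    → within-mono (inj₁ (0<y-x⇒x<y (<-respʳ (solve 2 (λ d e → e := d :+ e :- d) refl d e) 0<e))) xd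
      ; (suc i) → within-mono (inj₁ (0<y-x⇒x<y (<-respʳ (solve 2 (λ d e → d := d :+ e :- e) refl d e) 0<d))) (xe i) }

  sum-small : ∀ {n e} → 0# < e → ∃ λ d → 0# < d ×
              (∀ (u : Fin n → Carrier) → (∀ i → u i within d) → sum u within e)
  sum-small {zero}  0<e = 1# , 0<1 , λ _ _ → 0-within 0<e
  sum-small {suc n} 0<e
    with h , 0<h , h+h≈e ← half 0<e
    with d′ , 0<d′ , small ← sum-small {n} 0<h
    with d , 0<d , d≤h , d≤d′ ← lower 0<h 0<d′
    = d , 0<d , λ u ud → within-mono (inj₂ h+h≈e)
        (within-+ (within-mono d≤h (ud zero)) (small (u ∘ suc) (λ i → within-mono d≤d′ (ud (suc i)))))

module Topology (em : ExcludedMiddle 0ℓ) (ℝ : CompleteOrderedField) where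
  open OrderedField ℝ
  open Estimates ℝ
  open SemiringSum semiring using (∑-distrib-+; *-distribˡ-sum; sum-cong-≋)

  infix 4 _≈ₚ_
  infixl 6 _+[_]_

  _≈ₚ_ : ∀ {n} → Point ℝ n → Point ℝ n → Set
  x ≈ₚ y = ∀ i → x i ≈ y i

  _+[_]_ : ∀ {n} → Point ℝ n → Carrier → Point ℝ n → Point ℝ n
  (x +[ t ] y) i = x i + t * y i

  towards : ∀ {n} → Point ℝ n → Point ℝ n → Carrier → Point ℝ n
  towards x y t = x +[ t ] λ i → y i - x i

  Convex : ∀ {n} → Pred (Point ℝ n) 0ℓ → Set
  Convex S = ∀ {x y t} → S x → S y → 0# ≤ t → t ≤ 1# → S (towards x y t)

  open-box : ∀ {n} {U : Pred (Point ℝ n) 0ℓ} → Open ℝ U → ∀ {x} → U x →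
             ∃ λ e → 0# < e × (∀ y → (∀ i → y i - x i within e) → U y)
  open-box {U = U} oU {x} Ux with e , 0<e , box ← oU x Ux = e , 0<e , λ y near → box y λ i →
    0<y-x⇒x<y (<-respʳ (solve 3 (λ e x y → e :+ (y :- x) := y :- (x :- e)) refl e (x i) (y i)) (proj₂ (near i))) ,
    0<y-x⇒x<y (<-respʳ (solve 3 (λ e x y → e :- (y :- x) := x :+ e :- y) refl e (x i) (y i)) (proj₁ (near i)))

  open-resp : ∀ {n} {U : Pred (Point ℝ n) 0ℓ} → Open ℝ U → ∀ {x y} → x ≈ₚ y → U x → U y
  open-resp oU x≈y Ux with e , 0<e , box ← open-box oU Ux = box _ λ i →
    within-resp (sym (trans (+-congʳ (sym (x≈y i))) (-‿inverseʳ _))) (0-within 0<e)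

  -- If `b` bounds the coordinates of `y - x`, a change of the parameter by less than `e / b` moves
  -- each coordinate by less than `e`.
  open-along : ∀ {n} {U : Pred (Point ℝ n) 0ℓ} → Open ℝ U → ∀ {x y} s → U (towards x y s) →
               ∃ λ d → 0# < d × (∀ t → t - s within d → U (towards x y t))
  open-along oU {x} {y} s Us
    with e , 0<e , box ← open-box oU Us
    with b , 0<b , xyb ← within-common-bound (λ i → y i - x i)
    with i , bi≈1 ← inverse b (<⇒≉ 0<b ∘ sym) | 0<i ← 0<inverse 0<b
    = e * i , *-pos 0<e 0<i , λ t near → box _ λ k →
        within-mono (inj₂ (trans (*-assoc e i b) (trans (*-congˡ (trans (*-comm i b) bi≈1)) (*-identityʳ e))))
          (within-resp (solve 4 (λ x w s t → (t :- s) :* w := x :+ t :* w :- (x :+ s :* w))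
                          refl (x k) (y k - x k) s t)
             (within-* near (xyb k)))

  towards-0 : ∀ {n} (x y : Point ℝ n) → x ≈ₚ towards x y 0#
  towards-0 x y i = solve 2 (λ x y → x := x :+ :0 :* (y :- x)) refl (x i) (y i)

  towards-1 : ∀ {n} (x y : Point ℝ n) → towards x y 1# ≈ₚ y
  towards-1 x y i = solve 2 (λ x y → x :+ :1 :* (y :- x) := y) refl (x i) (y i)

  -- On the segment from a point of `U` to a point of `V`, let `s` be the supremum of the parameters
  -- of points of `U`; completeness is used here. Openness shows that the point at `s` can lie
  -- neither in `U` nor in `V`.
  convex⇒connected : ∀ {n} {S : Pred (Point ℝ n) 0ℓ} {p} → S p → Convex S → TopConnected ℝ S
  convex⇒connected {S = S} {p} Sp conv = (p , Sp) , λ U V oU oV cover (x , Sx , Ux) (y , Sy , Vy) →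
    decidable-stable em λ disjoint →
    let
      T : Pred Carrier 0ℓ
      T t = 0# ≤ t × t ≤ 1# × U (towards x y t)

      apart : ∀ {z} → S z → U z → ¬ V z
      apart Sz Uz Vz = disjoint (_ , Sz , Uz , Vz)

      ¬Uy : ¬ U y
      ¬Uy Uy = apart Sy Uy Vy

      T0 : T 0#
      T0 = ≤-refl , inj₁ 0<1 , open-resp oU (towards-0 x y) Ux

      (s , upper , least) = complete T (0# , T0) (1# , λ _ (_ , t≤1 , _) → t≤1)

      0≤s = upper 0# T0
      s≤1 = least 1# (λ _ (_ , t≤1 , _) → t≤1)

      U-beyond : U (towards x y s) → ⊥
      U-beyond Us =
        let (d , 0<d , near) = open-along oU s Us
            (h , 0<h , h+h≈d) = half 0<d
            h<d = h<h+h 0<h h+h≈d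
            s<s+h = 0<y-x⇒x<y (<-respʳ (solve 2 (λ s h → h := s :+ h :- s) refl s h) 0<h)
            Us+h = near (s + h)
              ( <-respʳ (solve 3 (λ s h d → d :- h := d :- (s :+ h :- s)) refl s h d) (0<y-x h<d)
              , <-respʳ (solve 3 (λ s h d → d :+ h := d :+ (s :+ h :- s)) refl s h d) (0<+ 0<d 0<h))
        -- Either a point beyond `s` still lies in `U`, or `s + h` exceeds one and then `y` itself
        -- does.
        in case≤ (s + h) 1#
          (λ s+h≤1 → <⇒≱ s<s+h (upper (s + h) (0≤+ 0≤s (inj₁ 0<h) , s+h≤1 , Us+h)))
          (λ 1<s+h → ¬Uy (open-resp oU (towards-1 x y) (near 1#
              ( <-respʳ (solve 3 (λ s h d → (s :+ h :- :1) :+ (d :- h) := d :- (:1 :- s)) refl s h d)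
                  (0<+ (0<y-x 1<s+h) (0<y-x h<d))
              , 0<+≤ 0<d (≤⇒0≤ s≤1)))))

      V-before : V (towards x y s) → ⊥
      V-before Vs =
        let (d , 0<d , near) = open-along oV s Vs
            s-d<s = 0<y-x⇒x<y (<-respʳ (solve 2 (λ s d → d := s :- (s :- d)) refl s d) 0<d)
        -- The last stretch of length `d` before `s` lies in `V`, so `s - d` is already an upper
        -- bound of `T`.
        in <⇒≱ s-d<s (least (s - d) λ t Tt@(0≤t , t≤1 , Ut) → ≮⇒≥ λ s-d<t →
             apart (conv Sx Sy 0≤t t≤1) Ut (near t
               ( <-respʳ (solve 3 (λ s t d → d :+ (s :- t) := d :- (t :- s)) refl s t d)
                   (0<+≤ 0<d (≤⇒0≤ (upper t Tt)))
               , <-respʳ (solve 3 (λ s t d → t :- (s :- d) := d :+ (t :- s)) refl s t d) (0<y-x s-d<t))))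
    in [ U-beyond , V-before ]′ (cover (conv Sx Sy 0≤s s≤1))
    where
    ≤⇒0≤ : ∀ {x y} → x ≤ y → 0# ≤ y - x
    ≤⇒0≤ (inj₁ x<y) = inj₁ (0<y-x x<y)
    ≤⇒0≤ {x} {y} (inj₂ x≈y) = inj₂ (sym (trans (+-congʳ (sym x≈y)) (-‿inverseʳ x)))

    case≤ : ∀ x y {A : Set} → (x ≤ y → A) → (y < x → A) → A
    case≤ x y f g with compare x y
    ... | tri< x<y _ _ = f (inj₁ x<y)
    ... | tri≈ _ x≈y _ = f (inj₂ x≈y)
    ... | tri> _ _ y<x = g y<x

  -- One law combines additivity and homogeneity; differences and the value at zero are obtained
  -- from it with `t = - 1#`.
  record IsLinearForm {n} (f : Point ℝ n → Carrier) : Set where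
    field
      cong  : ∀ {x y} → x ≈ₚ y → f x ≈ f y
      +*-homo : ∀ x t y → f (x +[ t ] y) ≈ f x + t * f y

    towards-homo : ∀ x y t → f (towards x y t) ≈ f x + t * (f y - f x)
    towards-homo x y t = trans (+*-homo x t _) (+-congˡ (*-congˡ (trans
      (cong {y = y +[ - 1# ] x} (λ i → solve 2 (λ x y → y :- x := y :+ (:- :1) :* x) refl (x i) (y i)))
      (trans (+*-homo y (- 1#) x)
        (solve 2 (λ a b → b :+ (:- :1) :* a := b :- a) refl (f x) (f y))))))

  module Arrangement {n : ℕ} {Index : Set} (φ : Index → Point ℝ n → Carrier)
    (φ-linear : ∀ J → IsLinearForm (φ J))
    (half-space-open : ∀ J c → Open ℝ (λ x → 0# < c * φ J x)) where

    Complement : Pred (Point ℝ n) 0ℓ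
    Complement = ∁ (⋃ Index (λ J → ker ℝ (φ J)))

    -- Products compare the sign of each form at `x` with its sign at `p`, so no sign vector has to
    -- be chosen.
    Cell : Point ℝ n → Pred (Point ℝ n) 0ℓ
    Cell p x = ∀ J → 0# < φ J p * φ J x

    cell-convex : ∀ p → Convex (Cell p)
    cell-convex p {x} {y} {t} px py 0≤t t≤1 J = positive t≤1
      where
      module φJ = IsLinearForm (φ-linear J)
      -- The first summand of (1 - t) φ(x) + t φ(y) is strictly positive only for `t < 1#`; the end
      -- point is treated apart.
      positive : t ≤ 1# → 0# < φ J p * φ J (towards x y t)
      positive (inj₁ t<1) = <-respʳ
        (trans (solve 4 (λ a x y t → (:1 :- t) :* (a :* x) :+ t :* (a :* y) := a :* (x :+ t :* (y :- x)))
                  refl (φ J p) (φ J x) (φ J y) t)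
               (*-congˡ (sym (φJ.towards-homo x y t))))
        (0<+≤ (*-pos (0<y-x t<1) (px J)) (0≤* 0≤t (inj₁ (py J))))
      positive (inj₂ t≈1) = <-respʳ (*-congˡ (φJ.cong {y} λ i →
        trans (sym (towards-1 x y i)) (+-congˡ (*-congʳ (sym t≈1))))) (py J)

    self-in-cell : ∀ {p} → Complement p → Cell p p
    self-in-cell p∉ J = 0<x*x λ φp≈0 → p∉ (J , φp≈0)

    cell⊆complement : ∀ {p x} → Cell p x → Complement x
    cell⊆complement px (J , φx≈0) = 0<*⇒≉0ʳ (px J) φx≈0

    opposite-side : ∀ J {p x} → φ J p * φ J x < 0# → 0# < - φ J p * φ J x
    opposite-side J {p} {x} neg =
      <-respʳ (solve 2 (λ a z → :- (a :* z) := (:- a) :* z) refl (φ J p) (φ J x)) (<0⇒0<- neg)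

    sides : ∀ {p x} → Complement p → Complement x → ∀ J → 0# < φ J p * φ J x ⊎ 0# < - φ J p * φ J x
    sides {p} {x} p∉ x∉ J with compare 0# (φ J p * φ J x)
    ... | tri< pos _ _ = inj₁ pos
    ... | tri≈ _ 0≈ _ = contradiction (sym 0≈) (x*y≉0 (λ e → p∉ (J , e)) (λ e → x∉ (J , e)))
    ... | tri> _ _ neg = inj₂ (opposite-side J {p} {x} neg)

    -- If `x` were on the other side of a hyperplane, its two open sides would cover `D` and both
    -- meet it, hence meet each other in `D`, although they are disjoint.
    connected⊆cell : ∀ {D : Pred (Point ℝ n) 0ℓ} {p x} → TopConnected ℝ D → (∀ {z} → D z → Complement z) →
                     D p → D x → Cell p x
    connected⊆cell {D} {p} {x} (_ , connected) D⊆ Dp Dx J with sides (D⊆ Dp) (D⊆ Dx) J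
    ... | inj₁ pos = pos
    ... | inj₂ neg
      with z , _ , pos , neg′ ← connected _ _ (half-space-open J (φ J p)) (half-space-open J (- φ J p))
             (λ Dz → sides (D⊆ Dp) (D⊆ Dz) J) (p , Dp , self-in-cell (D⊆ Dp) J) (x , Dx , neg)
      = contradiction (<-respʳ (solve 2 (λ a z → a :* z :+ (:- a) :* z := :0) refl (φ J p) (φ J z)) (0<+ pos neg′))
                      (<-irrefl refl)

    cell-connected : ∀ {p} → Complement p → TopConnected ℝ (Cell p)
    cell-connected p∉ = convex⇒connected (self-in-cell p∉) (cell-convex _)

    cell-component : ∀ {p} → Complement p → IsComponent ℝ Complement (Cell p)
    cell-component p∉ = cell⊆complement , cell-connected p∉ ,
      λ D conn ⊆D D⊆ Dx → connected⊆cell conn D⊆ (⊆D (self-in-cell p∉)) Dx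

    component⇒cell : ∀ {C} → IsComponent ℝ Complement C → ∃ λ p → Complement p × (∀ x → C x ⇔ Cell p x)
    component⇒cell (C⊆ , conn@((p , Cp) , _) , maximal) = p , C⊆ Cp , λ x →
      mk⇔ (connected⊆cell conn C⊆ Cp)
          (maximal (Cell p) (cell-connected (C⊆ Cp)) (connected⊆cell conn C⊆ Cp) cell⊆complement)

    -- Replaces the quantification over predicates by one over points: each component is the cell of
    -- one of its points.
    simplicial⇔cells : Simplicial ℝ (λ J → ker ℝ (φ J)) ⇔
                       (∀ p → Complement p → IsOpenSimplicialCone ℝ (Cell p))
    simplicial⇔cells = mk⇔ (λ simplicial p p∉ → simplicial _ (cell-component p∉)) λ cone C comp →
      let (p , p∉ , C⇔) = component⇒cell comp
          (v , indep , char) = cone p p∉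
      in v , indep , λ x → mk⇔ (Equivalence.to (char x) ∘ Equivalence.to (C⇔ x))
                               (Equivalence.from (C⇔ x) ∘ Equivalence.from (char x))

  coordinateSum-linear : ∀ {n} (I : Subset n) → IsLinearForm (coordinateSum ℝ I)
  coordinateSum-linear I = record
    { cong = λ x≈y → sum-cong-≋ λ i → if-cong (lookup I i) (x≈y i)
    ; +*-homo = λ x t y → trans
        (sum-cong-≋ {x = λ i → if lookup I i then x i + t * y i else 0#}
                    {y = λ i → (if lookup I i then x i else 0#) + t * (if lookup I i then y i else 0#)}
                    λ i → if-homo (lookup I i) (x i) t (y i))
        (trans (∑-distrib-+ (λ i → if lookup I i then x i else 0#) (λ i → t * (if lookup I i then y i else 0#)))
               (+-congˡ (sym (*-distribˡ-sum t (λ i → if lookup I i then y i else 0#)))))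
    }
    where
    if-cong : ∀ b {x y} → x ≈ y → (if b then x else 0#) ≈ (if b then y else 0#)
    if-cong false _   = refl
    if-cong true  x≈y = x≈y
    if-homo : ∀ b x t y → (if b then x + t * y else 0#) ≈ (if b then x else 0#) + t * (if b then y else 0#)
    if-homo false x t y = solve 1 (λ t → :0 := :0 :+ t :* :0) refl t
    if-homo true  x t y = refl

  -- If `b` bounds `c` and the coordinates of `y - x` are so small that their sum over `I` is below
  -- `c f(x) / b`, then `c f(y)` cannot reach zero.
  coordinateSum-half-space-open : ∀ {n} (I : Subset n) c → Open ℝ (λ x → 0# < c * coordinateSum ℝ I x)
  coordinateSum-half-space-open {n} I c x 0<cfx
    with b , 0<b , cb ← within-bound c
    with i , bi≈1 ← inverse b (<⇒≉ 0<b ∘ sym) | 0<i ← 0<inverse 0<b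
    with d , 0<d , small ← sum-small {n} (*-pos 0<cfx 0<i)
    = d , 0<d , λ y near →
      let z = λ k → y k - x k
          fz = coordinateSum ℝ I z
          z-small = λ k →
            <-respʳ (solve 3 (λ x y d → x :+ d :- y := d :- (y :- x)) refl (x k) (y k) d) (0<y-x (proj₂ (near k))) ,
            <-respʳ (solve 3 (λ x y d → y :- (x :- d) := d :+ (y :- x)) refl (x k) (y k) d) (0<y-x (proj₁ (near k)))
          fz-small = small (λ k → if lookup I k then z k else 0#) λ k → if-within (lookup I k) 0<d (z-small k)
          open IsLinearForm (coordinateSum-linear I)
          cfz = within-mono (inj₂ (trans (solve 3 (λ b e i → b :* (e :* i) := e :* (b :* i)) refl b _ i)
                                    (trans (*-congˡ bi≈1) (*-identityʳ _)))) (within-* cb fz-small)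
      in <-respʳ (trans (solve 3 (λ c a b → c :* a :+ c :* b := c :* (a :+ :1 :* b)) refl c (coordinateSum ℝ I x) fz)
             (*-congˡ (trans (sym (+*-homo x 1# z))
               (cong λ k → solve 2 (λ x y → x :+ :1 :* (y :- x) := y) refl (x k) (y k))))) (proj₂ cfz)
    where
    if-within : ∀ b {x e} → 0# < e → x within e → (if b then x else 0#) within e
    if-within false 0<e _ = 0-within 0<e
    if-within true  _   p = p

-- Simplicial cones

module SimplicialCones (em : ExcludedMiddle 0ℓ) (ℝ : CompleteOrderedField) where
  open OrderedField ℝ
  open Topology em ℝ
  open SemiringSum semiring using (sum; ∑-distrib-+; *-distribˡ-sum; sum-cong-≋; sum-replicate-zero)

  infix 4 _≟0

  _≟0 : ∀ x → Dec (x ≈ 0#)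
  x ≟0 with compare x 0#
  ... | tri< _ x≉0 _ = no x≉0
  ... | tri≈ _ x≈0 _ = yes x≈0
  ... | tri> _ x≉0 _ = no x≉0

  x*y≈0⇒y≈0 : ∀ {x y} → ¬ x ≈ 0# → x * y ≈ 0# → y ≈ 0#
  x*y≈0⇒y≈0 {y = y} x≉0 xy≈0 with y ≟0
  ... | yes y≈0 = y≈0
  ... | no  y≉0 = contradiction xy≈0 (x*y≉0 x≉0 y≉0)

  ≈0-stable : ∀ {x} → ¬ ¬ x ≈ 0# → x ≈ 0#
  ≈0-stable {x} = decidable-stable (x ≟0)

  unit : ∀ {n} → Fin n → Point ℝ n
  unit zero    zero    = 1#
  unit zero    (suc _) = 0#
  unit (suc _) zero    = 0#
  unit (suc i) (suc j) = unit i j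

  sum-zero : ∀ {n} {f : Fin n → Carrier} → (∀ i → f i ≈ 0#) → sum f ≈ 0#
  sum-zero {n} f≈0 = trans (sum-cong-≋ f≈0) (sum-replicate-zero n)

  unit-expansion : ∀ {n} (x : Point ℝ n) → combination ℝ x unit ≈ₚ x
  unit-expansion x zero = trans
    (+-cong (*-identityʳ _) (sum-zero λ i → zeroʳ (x (suc i)))) (+-identityʳ _)
  unit-expansion x (suc j) = trans
    (+-cong (zeroʳ _) (unit-expansion (x ∘ suc) j)) (+-identityˡ _)

  combination-linear : ∀ {n k} (v : Fin k → Point ℝ n) j → IsLinearForm (λ c → combination ℝ c v j)
  combination-linear v j = record
    { cong = λ c≈d → sum-cong-≋ λ i → *-congʳ (c≈d i)
    ; +*-homo = λ c t d → trans
        (sum-cong-≋ {x = λ i → (c i + t * d i) * v i j} {y = λ i → c i * v i j + t * (d i * v i j)} λ i →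
          solve 4 (λ c t d v → (c :+ t :* d) :* v := c :* v :+ t :* (d :* v)) refl (c i) t (d i) (v i j))
        (trans (∑-distrib-+ (λ i → c i * v i j) (λ i → t * (d i * v i j)))
               (+-congˡ (sym (*-distribˡ-sum t (λ i → d i * v i j)))))
    }

  module _ {n : ℕ} {f : Point ℝ n → Carrier} (f-linear : IsLinearForm f) where
    open IsLinearForm f-linear

    0-homo : f (λ _ → 0#) ≈ 0#
    0-homo = trans (cong λ i → solve 0 (:0 := :0 :+ (:- :1) :* :0) refl)
      (trans (+*-homo (λ _ → 0#) (- 1#) (λ _ → 0#))
             (solve 1 (λ a → a :+ (:- :1) :* a := :0) refl (f (λ _ → 0#))))

    combination-homo : ∀ {k} (c : Fin k → Carrier) v → f (combination ℝ c v) ≈ sum (λ i → c i * f (v i))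
    combination-homo {zero}  c v = 0-homo
    combination-homo {suc k} c v = trans
      (cong λ j → +-comm (c zero * v zero j) (combination ℝ (c ∘ suc) (v ∘ suc) j))
      (trans (+*-homo (combination ℝ (c ∘ suc) (v ∘ suc)) (c zero) (v zero))
             (trans (+-comm _ _) (+-congˡ (combination-homo (c ∘ suc) (v ∘ suc)))))

    linear-expansion : ∀ x → f x ≈ sum (λ i → x i * f (unit i))
    linear-expansion x = trans (cong (λ j → sym (unit-expansion x j))) (combination-homo x unit)

  -- `L` evaluates `n` wall forms and `M` is its inverse. The generators are the columns of `M`,
  -- each scaled by the value of its wall at `p`, which turns it to the side of `p`; the coordinates
  -- of `x` are then the quotients `L x k / L p k`.
  coordinates⇒simplicial : ∀ {n} {C : Pred (Point ℝ n) 0ℓ} (L M : Point ℝ n → Point ℝ n) →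
    (∀ {x y} → x ≈ₚ y → L x ≈ₚ L y) → (∀ j → IsLinearForm (λ c → M c j)) →
    (∀ c → L (M c) ≈ₚ c) → (∀ x → M (L x) ≈ₚ x) →
    ∀ p → (∀ k → ¬ L p k ≈ 0#) → (∀ x → C x ⇔ (∀ k → 0# < L p k * L x k)) → IsOpenSimplicialCone ℝ C
  coordinates⇒simplicial {n} {C} L M L-cong M-linear LM ML p Lp≉0 C⇔ = v , indep , char
    where
    v : Fin n → Point ℝ n
    v k j = L p k * M (unit k) j

    scaled : Point ℝ n → Point ℝ n
    scaled c k = c k * L p k

    combination≈M : ∀ c → combination ℝ c v ≈ₚ M (scaled c)
    combination≈M c j = trans (sum-cong-≋ λ k → sym (*-assoc (c k) (L p k) (M (unit k) j)))
                              (sym (linear-expansion (M-linear j) (scaled c)))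

    M-cong : ∀ {c d} → c ≈ₚ d → M c ≈ₚ M d
    M-cong c≈d j = IsLinearForm.cong (M-linear j) c≈d

    indep : LinearlyIndependent ℝ v
    indep c cv≈0 k = x*y≈0⇒y≈0 (Lp≉0 k) (begin
      L p k * c k                 ≈⟨ *-comm _ _ ⟩
      scaled c k                  ≈⟨ LM (scaled c) k ⟨
      L (M (scaled c)) k          ≈⟨ L-cong (λ j → trans (sym (combination≈M c j)) (trans (cv≈0 j) (sym (0-homo (M-linear j))))) k ⟩
      L (M (λ _ → 0#)) k          ≈⟨ LM (λ _ → 0#) k ⟩
      0#                          ∎)
      where open SetoidReasoning setoid

    char : ∀ x → C x ⇔ (∃ λ c → (∀ k → 0# < c k) × (∀ j → x j ≈ combination ℝ c v j))
    char x = mk⇔ to from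
      where
      to : C x → ∃ λ c → (∀ k → 0# < c k) × (∀ j → x j ≈ combination ℝ c v j)
      to Cx = c , (λ k → 0<*-cancelˡ (0<x*x (Lp≉0 k)) (<-respʳ (sym (rearrange k)) (Equivalence.to (C⇔ x) Cx k))) ,
        λ j → trans (sym (ML x j)) (trans (M-cong (λ k → sym (c-scaled k)) j) (sym (combination≈M c j)))
        where
        i = λ k → inverse (L p k) (Lp≉0 k)
        c = λ k → L x k * proj₁ (i k)
        c-scaled : scaled c ≈ₚ L x
        c-scaled k = trans (solve 3 (λ x i p → x :* i :* p := x :* (p :* i)) refl (L x k) (proj₁ (i k)) (L p k))
                           (trans (*-congˡ (proj₂ (i k))) (*-identityʳ _))
        rearrange : ∀ k → L p k * L p k * c k ≈ L p k * L x k
        rearrange k = trans (solve 2 (λ p c → p :* p :* c := p :* (c :* p)) refl (L p k) (c k)) (*-congˡ (c-scaled k))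
      from : (∃ λ c → (∀ k → 0# < c k) × (∀ j → x j ≈ combination ℝ c v j)) → C x
      from (c , 0<c , x≈) = Equivalence.from (C⇔ x) λ k → <-respʳ
        (trans (solve 2 (λ p c → c :* (p :* p) := p :* (c :* p)) refl (L p k) (c k))
          (*-congˡ (sym (trans (L-cong (λ j → trans (x≈ j) (combination≈M c j)) k) (LM (scaled c) k)))))
        (*-pos (0<c k) (0<x*x (Lp≉0 k)))

  -- For `b < 0#` the ray would reach zero at t = a / (- b).
  ray-nonneg : ∀ {a b} → 0# < a → (∀ {t} → 0# < t → 0# < a + t * b) → 0# ≤ b
  ray-nonneg {a} {b} 0<a ray = ≮⇒≥ λ b<0 →
    let 0<-b = <0⇒0<- b<0
        (i , -bi≈1) = inverse (- b) (<⇒≉ 0<-b ∘ sym)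
    in <-irrefl refl (<-respʳ (trans (solve 3 (λ a i b → a :+ a :* i :* b := a :* (:1 :- (:- b) :* i)) refl a i b)
         (trans (*-congˡ (trans (+-congˡ (-‿cong -bi≈1)) (-‿inverseʳ 1#))) (zeroʳ a)))
       (ray (*-pos 0<a (0<inverse 0<-b))))

  sum≉0 : ∀ {k} (f : Fin k → Carrier) → ¬ sum f ≈ 0# → ∃ λ i → ¬ f i ≈ 0#
  sum≉0 {zero}  f ≉0 = contradiction refl ≉0
  sum≉0 {suc k} f ≉0 with f zero ≟0
  ... | no  f0≉0 = zero , f0≉0
  ... | yes f0≈0 with i , fi≉0 ← sum≉0 (f ∘ suc) (λ e → ≉0 (trans (+-cong f0≈0 e) (+-identityˡ _))) = suc i , fi≉0

  sum-nonneg : ∀ {k} (f : Fin k → Carrier) → (∀ i → 0# ≤ f i) → 0# ≤ sum f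
  sum-nonneg {zero}  f 0≤f = ≤-refl
  sum-nonneg {suc k} f 0≤f = 0≤+ (0≤f zero) (sum-nonneg (f ∘ suc) (0≤f ∘ suc))

  x+y≈0⇒x≈0 : ∀ {x y} → 0# ≤ x → 0# ≤ y → x + y ≈ 0# → x ≈ 0#
  x+y≈0⇒x≈0 (inj₁ 0<x) 0≤y e = contradiction (sym e) (<⇒≉ (0<+≤ 0<x 0≤y))
  x+y≈0⇒x≈0 (inj₂ 0≈x) 0≤y e = sym 0≈x

  nonneg-sum≈0 : ∀ {k} (f : Fin k → Carrier) → (∀ i → 0# ≤ f i) → sum f ≈ 0# → ∀ i → f i ≈ 0#
  nonneg-sum≈0 f 0≤f e zero    = x+y≈0⇒x≈0 (0≤f zero) (sum-nonneg (f ∘ suc) (0≤f ∘ suc)) e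
  nonneg-sum≈0 f 0≤f e (suc i) = nonneg-sum≈0 (f ∘ suc) (0≤f ∘ suc)
    (x+y≈0⇒x≈0 (sum-nonneg (f ∘ suc) (0≤f ∘ suc)) (0≤f zero) (trans (+-comm _ _) e)) i

  -- Coordinates in a simplicial cell and common refinement

  module Riesz {n : ℕ} {Index : Set} (φ : Index → Point ℝ n → Carrier)
    (φ-linear : ∀ J → IsLinearForm (φ J))
    (half-space-open : ∀ J c → Open ℝ (λ x → 0# < c * φ J x)) where
    open Arrangement φ φ-linear half-space-open

    ClosedCell : Point ℝ n → Pred (Point ℝ n) 0ℓ
    ClosedCell p x = ∀ J → 0# ≤ φ J p * φ J x

    module ConeCoordinates {p : Point ℝ n} (p∉ : Complement p) (v : Fin n → Point ℝ n) (indep : LinearlyIndependent ℝ v)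
      (char : ∀ x → Cell p x ⇔ (∃ λ c → (∀ i → 0# < c i) × (∀ j → x j ≈ combination ℝ c v j))) where

      open SetoidReasoning setoid

      +*-homo : ∀ j c t d → combination ℝ (c +[ t ] d) v j ≈ combination ℝ c v j + t * combination ℝ d v j
      +*-homo j = IsLinearForm.+*-homo (combination-linear v j)

      unique : ∀ {c d} → combination ℝ c v ≈ₚ combination ℝ d v → c ≈ₚ d
      unique {c} {d} cv≈dv i = begin
        c i                          ≈⟨ solve 2 (λ c d → c := d :+ (c :+ (:- :1) :* d)) refl (c i) (d i) ⟩
        d i + (c i + (- 1#) * d i)   ≈⟨ +-congˡ (indep (c +[ - 1# ] d) (λ j → trans (+*-homo j c (- 1#) d)
                                          (trans (+-congʳ (cv≈dv j))
                                            (solve 1 (λ x → x :+ (:- :1) :* x := :0) refl (combination ℝ d v j)))) i) ⟩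
        d i + 0#                     ≈⟨ +-identityʳ _ ⟩
        d i                          ∎

      private
        p-coordinates = Equivalence.to (char p) (self-in-cell p∉)

      π : Point ℝ n
      π = proj₁ p-coordinates

      0<π : ∀ i → 0# < π i
      0<π = proj₁ (proj₂ p-coordinates)

      p≈ : p ≈ₚ combination ℝ π v
      p≈ = proj₂ (proj₂ p-coordinates)

      φ-ray : ∀ J t x → φ J p * φ J (p +[ t ] x) ≈ φ J p * φ J p + t * (φ J p * φ J x)
      φ-ray J t x = trans (*-congˡ (IsLinearForm.+*-homo (φ-linear J) p t x))
        (solve 3 (λ p t x → p :* (p :+ t :* x) := p :* p :+ t :* (p :* x)) refl (φ J p) t (φ J x))

      ray-in-cell : ∀ {t x} → 0# < t → ClosedCell p x → Cell p (p +[ t ] x)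
      ray-in-cell 0<t px J = <-respʳ (sym (φ-ray J _ _)) (0<+≤ (self-in-cell p∉ J) (0≤* (inj₁ 0<t) (px J)))

      -- Adding a positive multiple of a generator to `p` raises one coordinate and keeps the
      -- others, so the ray stays in the cell and `ray-nonneg` applies.
      v-closed : ∀ i → ClosedCell p (v i)
      v-closed i J = ray-nonneg (self-in-cell p∉ J) λ {t} 0<t → <-respʳ (φ-ray J t (v i))
        (Equivalence.from (char (p +[ t ] v i))
          ( π +[ t ] unit i
          , (λ k → 0<+≤ (0<π k) (0≤* (inj₁ 0<t) (unit-nonneg i k)))
          , λ j → sym (trans (+*-homo j π t (unit i))
              (+-cong (sym (p≈ j)) (*-congˡ (trans (sum-cong-≋ λ k → *-comm (unit i k) (v k j))
                (trans (sum-cong-≋ λ k → *-congˡ (unit-sym i k)) (unit-expansion (λ k → v k j) i)))))))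
          J)
        where
        unit-nonneg : ∀ {n} (i k : Fin n) → 0# ≤ unit i k
        unit-nonneg zero    zero    = inj₁ 0<1
        unit-nonneg zero    (suc _) = ≤-refl
        unit-nonneg (suc _) zero    = ≤-refl
        unit-nonneg (suc i) (suc k) = unit-nonneg i k
        unit-sym : ∀ {n} (i k : Fin n) → unit i k ≈ unit k i
        unit-sym zero    zero    = refl
        unit-sym zero    (suc _) = refl
        unit-sym (suc _) zero    = refl
        unit-sym (suc i) (suc k) = unit-sym i k

      NonnegCoordinates : Point ℝ n → Set
      NonnegCoordinates x = ∃ λ c → (∀ i → 0# ≤ c i) × x ≈ₚ combination ℝ c v

      -- The coordinates of `p + x` minus those of `p` are coordinates `χ` of `x`. For every `t > 0`
      -- the point `p + t x` is in the cell, and by uniqueness its positive coordinates are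
      -- `π + t χ`; so `χ` is nonnegative.
      closed-coordinates : ∀ {x} → ClosedCell p x → NonnegCoordinates x
      closed-coordinates {x} px
        with κ , _ , κ≈ ← Equivalence.to (char (p +[ 1# ] x)) (ray-in-cell 0<1 px)
        = χ , (λ i → ray-nonneg (0<π i) (along i)) , x≈
        where
        χ = κ +[ - 1# ] π
        x≈ : x ≈ₚ combination ℝ χ v
        x≈ j = sym (begin
          combination ℝ χ v j                                   ≈⟨ +*-homo j κ (- 1#) π ⟩
          combination ℝ κ v j + - 1# * combination ℝ π v j      ≈⟨ +-cong (sym (κ≈ j)) (*-congˡ (sym (p≈ j))) ⟩
          p j + 1# * x j + - 1# * p j                           ≈⟨ solve 2 (λ p x → p :+ :1 :* x :+ (:- :1) :* p := x) refl (p j) (x j) ⟩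
          x j                                                   ∎)
        along : ∀ i {t} → 0# < t → 0# < π i + t * χ i
        along i {t} 0<t
          with τ , 0<τ , τ≈ ← Equivalence.to (char (p +[ t ] x)) (ray-in-cell 0<t px)
          = <-respʳ (unique {τ} {π +[ t ] χ} (λ j → trans (sym (τ≈ j))
              (trans (+-cong (p≈ j) (*-congˡ (x≈ j))) (sym (+*-homo j π t χ)))) i) (0<τ i)

      φ-coordinates : ∀ J {x c} → x ≈ₚ combination ℝ c v → φ J x ≈ sum (λ i → c i * φ J (v i))
      φ-coordinates J {x} {c} x≈ = trans (IsLinearForm.cong (φ-linear J) x≈) (combination-homo (φ-linear J) c v)

      -- A form has one weak sign on all generators. It can therefore vanish at a nonnegative
      -- combination only by vanishing at each generator that occurs in it.
      vanishing : ∀ J {x c} → (∀ i → 0# ≤ c i) → x ≈ₚ combination ℝ c v → φ J x ≈ 0# →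
                  ∀ i → ¬ c i ≈ 0# → φ J (v i) ≈ 0#
      vanishing J {x} {c} 0≤c x≈ φx≈0 i cᵢ≉0 = x*y≈0⇒y≈0 (0<*⇒≉0ˡ (self-in-cell p∉ J))
        (x*y≈0⇒y≈0 cᵢ≉0 (nonneg-sum≈0 (λ k → c k * (φ J p * φ J (v k))) (λ k → 0≤* (0≤c k) (v-closed k J)) (begin
          sum (λ k → c k * (φ J p * φ J (v k)))   ≈⟨ sum-cong-≋ (λ k → solve 3 (λ c p v → c :* (p :* v) := p :* (c :* v)) refl (c k) (φ J p) (φ J (v k))) ⟩
          sum (λ k → φ J p * (c k * φ J (v k)))   ≈⟨ *-distribˡ-sum (φ J p) (λ k → c k * φ J (v k)) ⟨
          φ J p * sum (λ k → c k * φ J (v k))     ≈⟨ *-congˡ (φ-coordinates J x≈) ⟨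
          φ J p * φ J x                           ≈⟨ trans (*-congˡ φx≈0) (zeroʳ _) ⟩
          0#                                      ∎) i))

    -- The closure of a simplicial cone is a lattice cone, so a relation a + b ≈ c + d
    -- in it has a common refinement; here a would have to be refined by zero vectors only.
    quadrilateral⇒¬simplicial : ∀ {p a b c d} → Complement p →
      ClosedCell p a → ClosedCell p b → ClosedCell p c → ClosedCell p d →
      (∀ j → a j + b j ≈ c j + d j) →
      ∀ J₁ J₂ J₃ J₄ → φ J₁ a ≈ 0# → φ J₃ a ≈ 0# → ¬ φ J₂ a ≈ 0# → φ J₄ c ≈ 0# → φ J₂ d ≈ 0# →
      (∀ x → φ J₁ x ≈ 0# → φ J₃ x ≈ 0# → φ J₄ x ≈ 0# → φ J₂ x ≈ 0#) →
      ¬ IsOpenSimplicialCone ℝ (Cell p)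
    quadrilateral⇒¬simplicial {p} {a} {b} {c} {d} p∉ pa pb pc pd a+b≈c+d J₁ J₂ J₃ J₄ φ₁a φ₃a φ₂a φ₄c φ₂d dependent
      (v , indep , char) =
        refute (closed-coordinates pa) (closed-coordinates pb) (closed-coordinates pc) (closed-coordinates pd)
      where
      open ConeCoordinates p∉ v indep char
      open SetoidReasoning setoid

      refute : NonnegCoordinates a → NonnegCoordinates b → NonnegCoordinates c → NonnegCoordinates d → ⊥
      refute (α , 0≤α , a≈) (β , 0≤β , b≈) (γ , 0≤γ , c≈) (δ , 0≤δ , d≈)
        -- Some generator `v i` occurs in `a` and is off the second hyperplane. Like `a` it lies on
        -- the first and third, so by dependence it is off the fourth. Hence it occurs neither in
        -- `c`, which is on the fourth, nor in `d`, which is on the second, and `α i + β i`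
        -- vanishes.
        with i , αφ₂≉0 ← sum≉0 (λ i → α i * φ J₂ (v i)) (λ e → φ₂a (trans (φ-coordinates J₂ a≈) e))
        = αᵢ≉0 (x+y≈0⇒x≈0 (0≤α i) (0≤β i) (begin
            α i + β i        ≈⟨ +-congˡ (*-identityˡ _) ⟨
            α i + 1# * β i   ≈⟨ α+β≈γ+δ ⟩
            γ i + 1# * δ i   ≈⟨ +-cong γᵢ≈0 (*-congˡ δᵢ≈0) ⟩
            0# + 1# * 0#     ≈⟨ solve 0 (:0 :+ :1 :* :0 := :0) refl ⟩
            0#               ∎))
        where
        αᵢ≉0 : ¬ α i ≈ 0#
        αᵢ≉0 α≈0 = αφ₂≉0 (trans (*-congʳ α≈0) (zeroˡ _))
        φ₂vᵢ≉0 : ¬ φ J₂ (v i) ≈ 0#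
        φ₂vᵢ≉0 φ≈0 = αφ₂≉0 (trans (*-congˡ φ≈0) (zeroʳ _))
        φ₄vᵢ≉0 : ¬ φ J₄ (v i) ≈ 0#
        φ₄vᵢ≉0 φ₄≈0 = φ₂vᵢ≉0 (dependent (v i) (vanishing J₁ 0≤α a≈ φ₁a i αᵢ≉0)
                                              (vanishing J₃ 0≤α a≈ φ₃a i αᵢ≉0) φ₄≈0)
        α+β≈γ+δ : α i + 1# * β i ≈ γ i + 1# * δ i
        α+β≈γ+δ = unique {α +[ 1# ] β} {γ +[ 1# ] δ} (λ j → begin
          combination ℝ (α +[ 1# ] β) v j                       ≈⟨ +*-homo j α 1# β ⟩
          combination ℝ α v j + 1# * combination ℝ β v j        ≈⟨ +-cong (sym (a≈ j)) (trans (*-identityˡ _) (sym (b≈ j))) ⟩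
          a j + b j                                             ≈⟨ a+b≈c+d j ⟩
          c j + d j                                             ≈⟨ +-cong (c≈ j) (trans (d≈ j) (sym (*-identityˡ _))) ⟩
          combination ℝ γ v j + 1# * combination ℝ δ v j        ≈⟨ +*-homo j γ 1# δ ⟨
          combination ℝ (γ +[ 1# ] δ) v j                       ∎) i
        γᵢ≈0 : γ i ≈ 0#
        γᵢ≈0 = ≈0-stable λ γᵢ≉0 → φ₄vᵢ≉0 (vanishing J₄ 0≤γ c≈ φ₄c i γᵢ≉0)
        δᵢ≈0 : δ i ≈ 0#
        δᵢ≈0 = ≈0-stable λ δᵢ≉0 → φ₂vᵢ≉0 (vanishing J₂ 0≤δ d≈ φ₂d i δᵢ≉0)

-- Graphs whose arrangement is not simplicial

allSubsets : ∀ n → List (Subset n)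
allSubsets zero    = [] ∷ []
allSubsets (suc n) = List.map (inside ∷_) (allSubsets n) List.++ List.map (outside ∷_) (allSubsets n)

∈-allSubsets : ∀ {n} (I : Subset n) → I ∈ allSubsets n
∈-allSubsets []            = here ≡.refl
∈-allSubsets (inside  ∷ I) = ∈-++⁺ˡ (∈-map⁺ (inside ∷_) (∈-allSubsets I))
∈-allSubsets (outside ∷ I) = ∈-++⁺ʳ (List.map (inside ∷_) (allSubsets _)) (∈-map⁺ (outside ∷_) (∈-allSubsets I))

-- An integer counterpart of `coordinateSum` that evaluates, so that sign conditions on explicit
-- vectors are decided by computation.
total : ∀ {k} → Subset k → (Fin k → ℤ) → ℤ
total []      α = + 0
total (b ∷ B) α = (if b then α zero else + 0) ℤ.+ total B (α ∘ suc)

-- Generic points of a flat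

module GenericPoints (em : ExcludedMiddle 0ℓ) (ℝ : CompleteOrderedField) where
  open OrderedField ℝ
  open Topology em ℝ
  open SimplicialCones em ℝ
  open SemiringSum semiring using (sum)

  Eventually : Pred Carrier 0ℓ → Set
  Eventually P = ∃ λ B → ∀ {M} → B < M → P M

  eventually-× : ∀ {P Q} → Eventually P → Eventually Q → Eventually (λ M → P M × Q M)
  eventually-× (B , p) (C , q) with compare B C
  ... | tri< B<C _ _ = C , λ C<M → p (<-trans B<C C<M) , q C<M
  ... | tri≈ _ B≈C _ = C , λ C<M → p (<-respˡ (sym B≈C) C<M) , q C<M
  ... | tri> _ _ C<B = B , λ B<M → p B<M , q (<-trans C<B B<M)

  eventually-all : ∀ {A : Set} {P : A → Pred Carrier 0ℓ} (xs : List A) → (∀ x → Eventually (P x)) →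
                   Eventually (λ M → ∀ {x} → x ∈ xs → P x M)
  eventually-all []       ev = 0# , λ _ ()
  eventually-all (x ∷ xs) ev
    with B , all ← eventually-× (ev x) (eventually-all xs ev)
    = B , λ B<M → λ { (here ≡.refl) → proj₁ (all B<M) ; (there x∈) → proj₂ (all B<M) x∈ }

  eventually-witness : ∀ {P} → Eventually P → ∃ P
  eventually-witness (B , p) =
    B + 1# , p (0<y-x⇒x<y (<-respʳ (solve 1 (λ B → :1 := B :+ :1 :- B) refl B) 0<1))

  -- The product equals u² (M + w / u), hence the bound - w / u.
  eventually-dominates : ∀ u w → Eventually (λ M → ¬ u ≈ 0# → 0# < u * (w + M * u))
  eventually-dominates u w with u ≟0
  ... | yes u≈0 = 0# , λ _ u≉0 → contradiction u≈0 u≉0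
  ... | no  u≉0 with i , ui≈1 ← inverse u u≉0 = - (w * i) , λ {M} B<M _ →
    <-respʳ (trans (solve 4 (λ u w i M → u :* u :* (M :- (:- (w :* i))) := u :* (w :* (u :* i) :+ M :* u)) refl u w i M)
                   (*-congˡ (+-congʳ (trans (*-congˡ ui≈1) (*-identityʳ w)))))
            (*-pos (0<x*x u≉0) (0<y-x B<M))

  F : ∀ {n} → Subset n → Point ℝ n → Carrier
  F = coordinateSum ℝ

  module _ {n : ℕ} (I : Subset n) where
    open IsLinearForm (coordinateSum-linear I) public

  bit : Bool → Carrier
  bit b = if b then 1# else 0#

  sum-unit : ∀ {m} (b : Fin m → Bool) u → sum (λ i → if b i then unit u i else 0#) ≈ bit (b u)
  sum-unit b zero    = trans (+-congˡ (sum-zero λ i → if-zero (b (suc i)))) (+-identityʳ _)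
    where
    if-zero : ∀ a → (if a then 0# else 0#) ≈ 0#
    if-zero false = refl
    if-zero true  = refl
  sum-unit b (suc u) with b zero
  ... | false = trans (+-identityˡ _) (sum-unit (b ∘ suc) u)
  ... | true  = trans (+-identityˡ _) (sum-unit (b ∘ suc) u)

  F-unit : ∀ {n} (I : Subset n) u → F I (unit u) ≈ bit (lookup I u)
  F-unit I u = sum-unit (lookup I) u

  total-sum : ∀ {m} (B : Subset m) α → sum (λ i → fromℤ (α i) * bit (lookup B i)) ≈ fromℤ (total B α)
  total-sum []          α = refl
  total-sum (true ∷ B)  α = trans (+-cong (*-identityʳ _) (total-sum B (α ∘ suc))) (sym (fromℤ-+ (α zero) (total B (α ∘ suc))))
  total-sum (false ∷ B) α = trans (+-cong (zeroʳ _) (total-sum B (α ∘ suc))) (sym (fromℤ-+ (+ 0) (total B (α ∘ suc))))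

  module _ {n : ℕ} (Test : Pred (Point ℝ n) 0ℓ) where

    -- The hyperplane of `I` contains the flat spanned by `Test`.
    Killed : Subset n → Set
    Killed I = ∀ {z} → Test z → F I z ≈ 0#

    surviving-test : ∀ {I} → ¬ Killed I → ∃ λ z → Test z × ¬ F I z ≈ 0#
    surviving-test ¬kI = decidable-stable em λ none → ¬kI λ Tz → ≈0-stable λ FIz≉0 → none (_ , Tz , FIz≉0)

    -- To leave one more hyperplane, a test vector `z` off it is added to a multiple of `y` so large
    -- that the forms already nonzero stay so. Membership in the span of `Test` is recorded as the
    -- vanishing of all killed forms.
    generic-point : (Is : List (Subset n)) → ∃ λ y → (∀ I → Killed I → F I y ≈ 0#) ×
                    (∀ {I} → I ∈ Is → Killed I ⊎ ¬ F I y ≈ 0#)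
    generic-point [] = (λ _ → 0#) , (λ I _ → 0-homo (coordinateSum-linear I)) , λ ()
    generic-point (I ∷ Is) with y , killed , generic ← generic-point Is | em {Killed I} | F I y ≟0
    ... | yes kI | _        = y , killed , λ { (here ≡.refl) → inj₁ kI ; (there I∈) → generic I∈ }
    ... | no  _  | no FIy≉0 = y , killed , λ { (here ≡.refl) → inj₂ FIy≉0 ; (there I∈) → generic I∈ }
    ... | no ¬kI | yes FIy≈0
      with z , Tz , FIz≉0 ← surviving-test {I} ¬kI
      with M , dominates ← eventually-witness (eventually-all Is λ K → eventually-dominates (F K y) (F K z))
      = z +[ M ] y
      , (λ K kK → trans (+*-homo K z M y) (trans (+-cong (kK Tz) (*-congˡ (killed K kK)))
                    (solve 1 (λ M → :0 :+ M :* :0 := :0) refl M)))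
      , λ { (here ≡.refl) → inj₂ λ e → FIz≉0 (trans (sym (trans (+*-homo I z M y)
                (trans (+-congˡ (trans (*-congˡ FIy≈0) (zeroʳ M))) (+-identityʳ _)))) e)
          ; {K} (there K∈) → Sum.map₂ (λ FKy≉0 e →
                0<*⇒≉0ʳ (dominates K∈ FKy≉0) (trans (sym (+*-homo K z M y)) e)) (generic K∈) }

module Quadrilaterals (em : ExcludedMiddle 0ℓ) (ℝ : CompleteOrderedField) {n : ℕ} (G : Graph (Fin n)) where
  open OrderedField ℝ
  open Topology em ℝ
  open SimplicialCones em ℝ
  open GenericPoints em ℝ

  Index : Set
  Index = ∃ λ (I : Subset n) → Nonempty I × Connected (G [ I ])

  open Arrangement {Index = Index} (coordinateSum ℝ ∘ proj₁) (coordinateSum-linear ∘ proj₁)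
    (coordinateSum-half-space-open ∘ proj₁) public
  open Riesz {Index = Index} (coordinateSum ℝ ∘ proj₁) (coordinateSum-linear ∘ proj₁)
    (coordinateSum-half-space-open ∘ proj₁)

  AllSimplicial : Set
  AllSimplicial = ∀ p → Complement p → IsOpenSimplicialCone ℝ (Cell p)

  -- The configuration q is moved far along a generic point y that is annihilated by
  -- the killed forms: those do not notice, and all others become constant in sign.
  record Perturbation (Test : Pred (Point ℝ n) 0ℓ) (q : Fin 4 → Point ℝ n) : Set where
    field
      y         : Point ℝ n
      M         : Carrier
      killed    : ∀ I → Killed Test I → F I y ≈ 0#
      generic   : ∀ I → Killed Test I ⊎ ¬ F I y ≈ 0#
      dominates : ∀ I k → ¬ F I y ≈ 0# → 0# < F I y * (F I (q k) + M * F I y)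

  perturbation : ∀ Test q → Perturbation Test q
  perturbation Test q = record
    { y         = proj₁ point
    ; M         = proj₁ scale
    ; killed    = proj₁ (proj₂ point)
    ; generic   = λ I → proj₂ (proj₂ point) (∈-allSubsets I)
    ; dominates = λ I k → proj₂ scale (∈-allSubsets I) (∈-allFin k)
    }
    where
    point = generic-point Test (allSubsets n)
    scale = eventually-witness (eventually-all (allSubsets n) λ I → eventually-all (List.allFin 4) λ k →
      eventually-dominates (F I (proj₁ point)) (F I (q k)))

  -- A killed form does not notice the move, and `signs` puts the quadrilateral on one side of its
  -- hyperplane; any other form takes at all corners its sign at `y`. So the sum `p` of two opposite
  -- corners is off every hyperplane, and the corners lie in the closure of its cell.
  module Perturbed {Test : Pred (Point ℝ n) 0ℓ} {q : Fin 4 → Point ℝ n} (perturbation : Perturbation Test q)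
    (signs : ∀ (J : Index) → Killed Test (proj₁ J) →
      ∃ λ σ → 0# < σ * (F (proj₁ J) (q 0F) + F (proj₁ J) (q 1F)) × (∀ k → 0# ≤ σ * F (proj₁ J) (q k))) where
    open Perturbation perturbation

    moved : Fin 4 → Point ℝ n
    moved k = q k +[ M ] y

    p : Point ℝ n
    p = moved 0F +[ 1# ] moved 1F

    unmoved : ∀ I → Killed Test I → ∀ k → F I (moved k) ≈ F I (q k)
    unmoved I kI k = trans (+*-homo I (q k) M y)
      (trans (+-congˡ (trans (*-congˡ (killed I kI)) (zeroʳ M))) (+-identityʳ _))

    Fp : ∀ I → F I p ≈ F I (moved 0F) + F I (moved 1F)
    Fp I = trans (+*-homo I (moved 0F) 1# (moved 1F)) (+-congˡ (*-identityˡ _))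

    signed : ∀ (J : Index) → ∃ λ σ → 0# < σ * F (proj₁ J) p × (∀ k → 0# ≤ σ * F (proj₁ J) (moved k))
    signed J@(I , _) with generic I
    ... | inj₁ kI with σ , pos , nonneg ← signs J kI = σ
      , <-respʳ (*-congˡ (sym (trans (Fp I) (+-cong (unmoved I kI 0F) (unmoved I kI 1F))))) pos
      , λ k → ≤-respʳ (*-congˡ (sym (unmoved I kI k))) (nonneg k)
    ... | inj₂ FIy≉0 = F I y
      , <-respʳ (trans (sym (distribˡ _ _ _)) (*-congˡ (sym (Fp I)))) (0<+ (pos 0F) (pos 1F))
      , λ k → inj₁ (pos k)
      where
      pos : ∀ k → 0# < F I y * F I (moved k)
      pos k = <-respʳ (*-congˡ (sym (+*-homo I (q k) M y))) (dominates I k FIy≉0)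

    p∉ : Complement p
    p∉ (J , Fp≈0) = 0<*⇒≉0ʳ (proj₁ (proj₂ (signed J))) Fp≈0

    closed : ∀ k → ClosedCell p (moved k)
    closed k J with σ , pos , nonneg ← signed J = sign-agree-≤ {σ} pos (nonneg k)

    moved-sum : (∀ j → q 0F j + q 1F j ≈ q 2F j + q 3F j) → ∀ j → moved 0F j + moved 1F j ≈ moved 2F j + moved 3F j
    moved-sum q-sum j = begin
      moved 0F j + moved 1F j                 ≈⟨ regroup (q 0F j) (q 1F j) M (y j) ⟩
      q 0F j + q 1F j + (M * y j + M * y j)   ≈⟨ +-congʳ (q-sum j) ⟩
      q 2F j + q 3F j + (M * y j + M * y j)   ≈⟨ regroup (q 2F j) (q 3F j) M (y j) ⟨
      moved 2F j + moved 3F j                 ∎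
      where
      open SetoidReasoning setoid
      regroup : ∀ a b m z → a + m * z + (b + m * z) ≈ a + b + (m * z + m * z)
      regroup = solve 4 (λ a b m z → a :+ m :* z :+ (b :+ m :* z) := a :+ b :+ (m :* z :+ m :* z)) refl

  killed-quadrilateral : (Test : Pred (Point ℝ n) 0ℓ) (q : Fin 4 → Point ℝ n) →
    (∀ j → q 0F j + q 1F j ≈ q 2F j + q 3F j) →
    (∀ (J : Index) → Killed Test (proj₁ J) →
      ∃ λ σ → 0# < σ * (F (proj₁ J) (q 0F) + F (proj₁ J) (q 1F)) × (∀ k → 0# ≤ σ * F (proj₁ J) (q k))) →
    ∀ J₁ J₂ J₃ J₄ → (k₁ : Killed Test (proj₁ J₁)) (k₂ : Killed Test (proj₁ J₂))
    (k₃ : Killed Test (proj₁ J₃)) (k₄ : Killed Test (proj₁ J₄)) →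
    F (proj₁ J₁) (q 0F) ≈ 0# → F (proj₁ J₃) (q 0F) ≈ 0# → ¬ F (proj₁ J₂) (q 0F) ≈ 0# →
    F (proj₁ J₄) (q 2F) ≈ 0# → F (proj₁ J₂) (q 3F) ≈ 0# →
    (∀ x → F (proj₁ J₁) x ≈ 0# → F (proj₁ J₃) x ≈ 0# → F (proj₁ J₄) x ≈ 0# → F (proj₁ J₂) x ≈ 0#) →
    ¬ AllSimplicial
  killed-quadrilateral Test q q-sum signs J₁ J₂ J₃ J₄ k₁ k₂ k₃ k₄ F₁q₀ F₃q₀ F₂q₀ F₄q₂ F₂q₃ dependent simplicial =
    quadrilateral⇒¬simplicial p∉ (closed 0F) (closed 1F) (closed 2F) (closed 3F) (moved-sum q-sum) J₁ J₂ J₃ J₄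
      (trans (unmoved (proj₁ J₁) k₁ 0F) F₁q₀) (trans (unmoved (proj₁ J₃) k₃ 0F) F₃q₀)
      (λ e → F₂q₀ (trans (sym (unmoved (proj₁ J₂) k₂ 0F)) e))
      (trans (unmoved (proj₁ J₄) k₄ 2F) F₄q₂) (trans (unmoved (proj₁ J₂) k₂ 3F) F₂q₃) dependent (simplicial p p∉)
    where open Perturbed (perturbation Test q) signs

ι : Bool → ℤ
ι b = if b then + 1 else + 0

-- `f` lists the values of a form at the four corners. Strictness for the diagonal `f 0F`, `f 1F`
-- keeps the centre off the hyperplane.
Positive : (Fin 4 → ℤ) → Set
Positive f = + 0 ℤ.< f 0F ℤ.+ f 1F × (∀ k → + 0 ℤ.≤ f k)

OneSided : ∀ {k} → (Fin 4 → Fin k → ℤ) → Subset k → Set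
OneSided α B = Positive (λ k → total B (α k)) ⊎ Positive (λ k → ℤ.- total B (α k))

oneSided? : ∀ {k} (α : Fin 4 → Fin k → ℤ) B → Dec (OneSided α B)
oneSided? α B = positive? _ ⊎-dec positive? _
  where
  positive? : ∀ f → Dec (Positive f)
  positive? f = (+ 0 ℤ.<? f 0F ℤ.+ f 1F) ×-dec Fin.all? (λ k → + 0 ℤ.≤? f k)

-- These data describe a flat: `P` selects vertices, `c` divides them into classes with
-- representatives `rep`, and `τ` weights the classes. The killed sets turn out to be the unions of
-- classes of total weight zero, so their signs are a finite problem in `k` alone.
module Colourings (em : ExcludedMiddle 0ℓ) (ℝ : CompleteOrderedField) {n : ℕ} (G : Graph (Fin n))
  {D : Set} (P : D → Fin n) (P-injective : ∀ {d e} → P d ≡ P e → d ≡ e)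
  {k : ℕ} (c : D → Fin k) (rep : Fin k → D) (c-rep : ∀ i → c (rep i) ≡ i)
  (τ : Fin k → ℤ) where
  open OrderedField ℝ
  open Topology em ℝ
  open SimplicialCones em ℝ
  open GenericPoints em ℝ
  open Quadrilaterals em ℝ G
  open SemiringSum semiring using (sum-cong-≋; ∑-distrib-+)

  colour : Fin n → Maybe (Fin k)
  colour u with em {∃ λ d → P d ≡ u}
  ... | yes (d , _) = just (c d)
  ... | no  _       = nothing

  colour-P : ∀ d → colour (P d) ≡ just (c d)
  colour-P d with em {∃ λ e → P e ≡ P d}
  ... | yes (e , Pe≡Pd) = ≡.cong (just ∘ c) (P-injective Pe≡Pd)
  ... | no  ∄e          = contradiction (d , ≡.refl) ∄e

  block : Subset k → Subset n
  block B = tabulate λ u → maybe′ (lookup B) false (colour u)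

  lookup-block : ∀ B u → lookup (block B) u ≡ maybe′ (lookup B) false (colour u)
  lookup-block B u = lookup∘tabulate _ u

  lookup-block-P : ∀ B d → lookup (block B) (P d) ≡ lookup B (c d)
  lookup-block-P B d = ≡.trans (lookup-block B (P d)) (≡.cong (maybe′ (lookup B) false) (colour-P d))

  lookup-block-outer : ∀ B u → (∀ d → P d ≢ u) → lookup (block B) u ≡ false
  lookup-block-outer B u outer = ≡.trans (lookup-block B u) (≡.cong (maybe′ (lookup B) false) colour≡nothing)
    where
    colour≡nothing : colour u ≡ nothing
    colour≡nothing with em {∃ λ d → P d ≡ u}
    ... | yes (d , Pd≡u) = contradiction Pd≡u (outer d)
    ... | no  _          = ≡.refl

  block-member : ∀ {B u} → lookup (block B) u ≡ true → ∃ λ d → P d ≡ u × lookup B (c d) ≡ true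
  block-member {B} {u} u∈ = decidable-stable em λ none →
    contradiction (≡.trans (≡.sym (lookup-block-outer B u λ { d ≡.refl →
      none (d , ≡.refl , ≡.trans (≡.sym (lookup-block-P B d)) u∈) })) u∈) λ ()

  -- The form of a union of classes sees only the sums over classes, so the weight of a class may be
  -- put on its representative.
  place : (Fin k → ℤ) → Point ℝ n
  place α = combination ℝ (fromℤ ∘ α) (unit ∘ P ∘ rep)

  -- A set killed by `same` contains each class wholly or not at all, one killed by `outer` has only
  -- selected vertices, and one killed by `twist` has total weight zero.
  data Test : Pred (Point ℝ n) 0ℓ where
    same  : ∀ d e → c d ≡ c e → Test (unit (P d) +[ - 1# ] unit (P e))
    outer : ∀ u → (∀ d → P d ≢ u) → Test (unit u)
    twist : Test (place τ)

  F-place : ∀ (I : Subset n) B α → (∀ i → lookup I (P (rep i)) ≡ lookup B i) → F I (place α) ≈ fromℤ (total B α)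
  F-place I B α agree = trans (combination-homo (coordinateSum-linear I) (fromℤ ∘ α) (unit ∘ P ∘ rep))
    (trans (sum-cong-≋ λ i → *-congˡ {fromℤ (α i)} (trans (F-unit I (P (rep i))) (reflexive (≡.cong bit (agree i)))))
           (total-sum B α))

  F-block-place : ∀ B α → F (block B) (place α) ≈ fromℤ (total B α)
  F-block-place B α = F-place (block B) B α λ i → ≡.trans (lookup-block-P B (rep i)) (≡.cong (lookup B) (c-rep i))

  F-difference : ∀ (I : Subset n) u v → F I (unit u +[ - 1# ] unit v) ≈ bit (lookup I u) + - 1# * bit (lookup I v)
  F-difference I u v = trans (+*-homo I (unit u) (- 1#) (unit v)) (+-cong (F-unit I u) (*-congˡ (F-unit I v)))

  block-killed : ∀ B → total B τ ≡ + 0 → Killed Test (block B)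
  block-killed B eq (same d e cd≡ce) = trans (F-difference (block B) (P d) (P e))
    (trans (+-congʳ (reflexive (≡.cong bit (≡.trans (lookup-block-P B d)
      (≡.trans (≡.cong (lookup B) cd≡ce) (≡.sym (lookup-block-P B e)))))))
      (solve 1 (λ a → a :+ (:- :1) :* a := :0) refl (bit (lookup (block B) (P e)))))
  block-killed B eq (outer u u-outer) = trans (F-unit (block B) u) (reflexive (≡.cong bit (lookup-block-outer B u u-outer)))
  block-killed B eq twist = trans (F-block-place B τ) (reflexive (≡.cong fromℤ eq))

  killed⇒block : ∀ I → Killed Test I → ∃ λ B → I ≡ block B × total B τ ≡ + 0
  killed⇒block I kI = B , I≡block , fromℤ≈0⇒≡0 (trans (sym (F-place I B τ (λ i → ≡.sym (lookup∘tabulate _ i)))) (kI twist))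
    where
    B = tabulate (lookup I ∘ P ∘ rep)

    bit-injective : ∀ a b → bit a + - 1# * bit b ≈ 0# → a ≡ b
    bit-injective false false _ = ≡.refl
    bit-injective true  true  _ = ≡.refl
    bit-injective true  false e = contradiction (trans (sym e) (solve 0 (:1 :+ (:- :1) :* :0 := :1) refl)) 0≉1
    bit-injective false true  e = contradiction
      (trans (sym (trans (+-congʳ e) (+-identityˡ 1#))) (solve 0 (:0 :+ (:- :1) :* :1 :+ :1 := :0) refl)) (0≉1 ∘ sym)

    bit≈0 : ∀ a → bit a ≈ 0# → a ≡ false
    bit≈0 false _ = ≡.refl
    bit≈0 true  e = contradiction (sym e) 0≉1

    agree : ∀ u → lookup I u ≡ maybe′ (lookup B) false (colour u)
    agree u with em {∃ λ d → P d ≡ u}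
    ... | yes (d , ≡.refl) = ≡.trans
      (bit-injective _ _ (trans (sym (F-difference I (P d) (P (rep (c d))))) (kI (same d (rep (c d)) (≡.sym (c-rep (c d)))))))
      (≡.sym (lookup∘tabulate (lookup I ∘ P ∘ rep) (c d)))
    ... | no  ∄d = bit≈0 _ (trans (sym (F-unit I u)) (kI (outer u λ d Pd≡u → ∄d (d , Pd≡u))))

    I≡block : I ≡ block B
    I≡block = ≡.trans (≡.sym (tabulate∘lookup I)) (tabulate-cong agree)

  -- Each class is counted equally often on both sides, and a vertex outside the classes is not
  -- counted at all.
  block-relation : ∀ B₁ B₂ B₃ B₄ → (∀ i → ι (lookup B₁ i) ℤ.+ ι (lookup B₂ i) ≡ ι (lookup B₃ i) ℤ.+ ι (lookup B₄ i)) →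
                   ∀ x → F (block B₁) x + F (block B₂) x ≈ F (block B₃) x + F (block B₄) x
  block-relation B₁ B₂ B₃ B₄ rel x = trans (sym (∑-distrib-+ (term B₁) (term B₂)))
    (trans (sum-cong-≋ pointwise) (∑-distrib-+ (term B₃) (term B₄)))
    where
    term : Subset k → Fin n → Carrier
    term B u = if lookup (block B) u then x u else 0#

    if≈ι* : ∀ b z → (if b then z else 0#) ≈ fromℤ (ι b) * z
    if≈ι* true  z = sym (*-identityˡ z)
    if≈ι* false z = sym (zeroˡ z)

    rel′ : ∀ m → ι (maybe′ (lookup B₁) false m) ℤ.+ ι (maybe′ (lookup B₂) false m) ≡
                 ι (maybe′ (lookup B₃) false m) ℤ.+ ι (maybe′ (lookup B₄) false m)
    rel′ nothing  = ≡.refl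
    rel′ (just i) = rel i

    two : ∀ B C u → term B u + term C u ≈
          fromℤ (ι (maybe′ (lookup B) false (colour u)) ℤ.+ ι (maybe′ (lookup C) false (colour u))) * x u
    two B C u = trans
      (+-cong (trans (reflexive (≡.cong (if_then x u else 0#) (lookup-block B u))) (if≈ι* _ (x u)))
              (trans (reflexive (≡.cong (if_then x u else 0#) (lookup-block C u))) (if≈ι* _ (x u))))
      (trans (sym (distribʳ (x u) _ _)) (*-congʳ (sym (fromℤ-+ (ι (maybe′ (lookup B) false (colour u))) _))))

    pointwise : ∀ u → term B₁ u + term B₂ u ≈ term B₃ u + term B₄ u
    pointwise u = trans (two B₁ B₂ u)
      (trans (*-congʳ (reflexive (≡.cong fromℤ (rel′ (colour u))))) (sym (two B₃ B₄ u)))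

  -- `G` enters the hypotheses only through the connectedness of blocks; the others concern integers
  -- and subsets of `Fin k` and are settled by evaluation in the applications.
  coloured-quadrilateral : (α : Fin 4 → Fin k → ℤ) → (∀ i → α 0F i ℤ.+ α 1F i ≡ α 2F i ℤ.+ α 3F i) →
    (∀ B → Nonempty (block B) → Connected (G [ block B ]) → total B τ ≡ + 0 → OneSided α B) →
    (B : Fin 4 → Subset k) → (∀ l → total (B l) τ ≡ + 0) →
    (∀ l → Nonempty (block (B l)) × Connected (G [ block (B l) ])) →
    (∀ i → ι (lookup (B 0F) i) ℤ.+ ι (lookup (B 1F) i) ≡ ι (lookup (B 2F) i) ℤ.+ ι (lookup (B 3F) i)) →
    total (B 0F) (α 0F) ≡ + 0 → total (B 2F) (α 0F) ≡ + 0 → total (B 1F) (α 0F) ≢ + 0 →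
    total (B 3F) (α 2F) ≡ + 0 → total (B 1F) (α 3F) ≡ + 0 → ¬ AllSimplicial
  coloured-quadrilateral α α-sum oneSided B Bτ conn rel B₀α₀ B₂α₀ B₁α₀ B₃α₂ B₁α₃ =
    killed-quadrilateral Test (place ∘ α) place-sum signs
      (J 0F) (J 1F) (J 2F) (J 3F) (killed 0F) (killed 1F) (killed 2F) (killed 3F)
      (vanish 0F 0F B₀α₀) (vanish 2F 0F B₂α₀)
      (λ e → B₁α₀ (fromℤ≈0⇒≡0 (trans (sym (F-block-place (B 1F) (α 0F))) e)))
      (vanish 3F 2F B₃α₂) (vanish 1F 3F B₁α₃) dependent
    where
    J : Fin 4 → Index
    J l = block (B l) , conn l

    killed : ∀ l → Killed Test (block (B l))
    killed l = block-killed (B l) (Bτ l)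

    vanish : ∀ l m → total (B l) (α m) ≡ + 0 → F (block (B l)) (place (α m)) ≈ 0#
    vanish l m e = trans (F-block-place (B l) (α m)) (reflexive (≡.cong fromℤ e))

    place-+ : ∀ β γ j → place β j + place γ j ≈ place (λ i → β i ℤ.+ γ i) j
    place-+ β γ j = trans (sym (∑-distrib-+ (λ i → fromℤ (β i) * e i) (λ i → fromℤ (γ i) * e i)))
      (sum-cong-≋ {x = λ i → fromℤ (β i) * e i + fromℤ (γ i) * e i} {y = λ i → fromℤ (β i ℤ.+ γ i) * e i}
        λ i → trans (sym (distribʳ _ _ _)) (*-congʳ (sym (fromℤ-+ (β i) (γ i)))))
      where
      e : Fin k → Carrier
      e i = unit (P (rep i)) j

    place-sum : ∀ j → place (α 0F) j + place (α 1F) j ≈ place (α 2F) j + place (α 3F) j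
    place-sum j = trans (place-+ (α 0F) (α 1F) j)
      (trans (sum-cong-≋ λ i → *-congʳ {unit (P (rep i)) j} (reflexive (≡.cong fromℤ (α-sum i)))) (sym (place-+ (α 2F) (α 3F) j)))

    signs : ∀ (J : Index) → Killed Test (proj₁ J) →
      ∃ λ σ → 0# < σ * (F (proj₁ J) (place (α 0F)) + F (proj₁ J) (place (α 1F))) ×
              (∀ l → 0# ≤ σ * F (proj₁ J) (place (α l)))
    signs (I , nonempty , connected) kI with B , ≡.refl , Bτ ← killed⇒block I kI with oneSided B nonempty connected Bτ
    ... | inj₁ (pos , nonneg) = 1#
      , <-respʳ (trans (fromℤ-+ (total B (α 0F)) _) (trans (+-cong (sym (F-block-place B (α 0F))) (sym (F-block-place B (α 1F)))) (sym (*-identityˡ _))))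
          (fromℤ-pos pos)
      , λ l → ≤-respʳ (trans (sym (F-block-place B (α l))) (sym (*-identityˡ _))) (fromℤ-nonneg (nonneg l))
    ... | inj₂ (pos , nonneg) = - 1#
      , <-respʳ (trans (fromℤ-+ (ℤ.- total B (α 0F)) _) (trans (+-cong (negated 0F) (negated 1F)) (sym (distribˡ _ _ _))))
          (fromℤ-pos pos)
      , λ l → ≤-respʳ (negated l) (fromℤ-nonneg (nonneg l))
      where
      negated : ∀ l → fromℤ (ℤ.- total B (α l)) ≈ - 1# * F (block B) (place (α l))
      negated l = trans (fromℤ-neg (total B (α l))) (trans (-‿cong (sym (F-block-place B (α l))))
        (solve 1 (λ a → :- a := (:- :1) :* a) refl (F (block B) (place (α l)))))

    dependent : ∀ x → F (block (B 0F)) x ≈ 0# → F (block (B 2F)) x ≈ 0# → F (block (B 3F)) x ≈ 0# → F (block (B 1F)) x ≈ 0#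
    dependent x F₀≈0 F₂≈0 F₃≈0 = begin
      F (block (B 1F)) x                        ≈⟨ +-identityˡ _ ⟨
      0# + F (block (B 1F)) x                   ≈⟨ +-congʳ F₀≈0 ⟨
      F (block (B 0F)) x + F (block (B 1F)) x   ≈⟨ block-relation (B 0F) (B 1F) (B 2F) (B 3F) rel x ⟩
      F (block (B 2F)) x + F (block (B 3F)) x   ≈⟨ +-cong F₂≈0 F₃≈0 ⟩
      0# + 0#                                   ≈⟨ +-identityʳ 0# ⟩
      0#                                        ∎
      where open SetoidReasoning setoid

  block-connected : ∀ B d → lookup B (c d) ≡ true →
    (∀ e → lookup B (c e) ≡ true →
      Star (λ x y → Adj G (P x) (P y) × lookup B (c x) ≡ true × lookup B (c y) ≡ true) e d) →
    Nonempty (block B) × Connected (G [ block B ])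
  block-connected B d d∈ reach = (P d , member d∈) , (P d , member d∈) , λ u v → to-base u ◅◅ reverse (symm G) (to-base v)
    where
    member : ∀ {e} → lookup B (c e) ≡ true → block B Vec.[ P e ]= true
    member {e} e∈ = lookup⇒[]= (P e) (block B) (≡.trans (lookup-block-P B e) e∈)

    lift : ∀ {e} (e∈ : block B Vec.[ P e ]= true) →
      Star (λ x y → Adj G (P x) (P y) × lookup B (c x) ≡ true × lookup B (c y) ≡ true) e d →
      Star (Adj (G [ block B ])) (P e , e∈) (P d , member d∈)
    lift e∈ ε with ≡.refl ← []=-irrelevant e∈ (member d∈) = ε
    lift e∈ ((adj , _ , y∈) ◅ path) = adj ◅ lift (member y∈) path

    to-base : ∀ u → Star (Adj (G [ block B ])) u (P d , member d∈)
    to-base (u , u∈) with e , ≡.refl , e∈ ← block-member {B} ([]=⇒lookup u∈) = lift u∈ (reach e e∈)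

adjacent⇒≢ : ∀ {V} (G : Graph V) {x y} → Adj G x y → x ≢ y
adjacent⇒≢ G xy x≡y = irrefl G x≡y xy

corners : {A : Set} → A → A → A → A → Fin 4 → A
corners x₀ x₁ x₂ x₃ = lookup (x₀ ∷ x₁ ∷ x₂ ∷ x₃ ∷ [])

corners-injective : {A : Set} {x₀ x₁ x₂ x₃ : A} → x₀ ≢ x₁ → x₀ ≢ x₂ → x₀ ≢ x₃ → x₁ ≢ x₂ → x₁ ≢ x₃ → x₂ ≢ x₃ →
  ∀ {i j} → corners x₀ x₁ x₂ x₃ i ≡ corners x₀ x₁ x₂ x₃ j → i ≡ j
corners-injective ≢01 ≢02 ≢03 ≢12 ≢13 ≢23 {0F} {0F} _ = ≡.refl
corners-injective ≢01 ≢02 ≢03 ≢12 ≢13 ≢23 {0F} {1F} e = contradiction e ≢01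
corners-injective ≢01 ≢02 ≢03 ≢12 ≢13 ≢23 {0F} {2F} e = contradiction e ≢02
corners-injective ≢01 ≢02 ≢03 ≢12 ≢13 ≢23 {0F} {3F} e = contradiction e ≢03
corners-injective ≢01 ≢02 ≢03 ≢12 ≢13 ≢23 {1F} {0F} e = contradiction (≡.sym e) ≢01
corners-injective ≢01 ≢02 ≢03 ≢12 ≢13 ≢23 {1F} {1F} _ = ≡.refl
corners-injective ≢01 ≢02 ≢03 ≢12 ≢13 ≢23 {1F} {2F} e = contradiction e ≢12
corners-injective ≢01 ≢02 ≢03 ≢12 ≢13 ≢23 {1F} {3F} e = contradiction e ≢13
corners-injective ≢01 ≢02 ≢03 ≢12 ≢13 ≢23 {2F} {0F} e = contradiction (≡.sym e) ≢02
corners-injective ≢01 ≢02 ≢03 ≢12 ≢13 ≢23 {2F} {1F} e = contradiction (≡.sym e) ≢12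
corners-injective ≢01 ≢02 ≢03 ≢12 ≢13 ≢23 {2F} {2F} _ = ≡.refl
corners-injective ≢01 ≢02 ≢03 ≢12 ≢13 ≢23 {2F} {3F} e = contradiction e ≢23
corners-injective ≢01 ≢02 ≢03 ≢12 ≢13 ≢23 {3F} {0F} e = contradiction (≡.sym e) ≢03
corners-injective ≢01 ≢02 ≢03 ≢12 ≢13 ≢23 {3F} {1F} e = contradiction (≡.sym e) ≢13
corners-injective ≢01 ≢02 ≢03 ≢12 ≢13 ≢23 {3F} {2F} e = contradiction (≡.sym e) ≢23
corners-injective ≢01 ≢02 ≢03 ≢12 ≢13 ≢23 {3F} {3F} _ = ≡.refl

decided : ∀ {k} (excluded : List (Subset k)) (τ : Fin k → ℤ) (α : Fin 4 → Fin k → ℤ) →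
  Dec (∃ λ B → total B τ ≡ + 0 × All (B ≢_) excluded × ¬ OneSided α B)
decided excluded τ α = anySubset? λ B →
  (total B τ ℤ.≟ + 0) ×-dec All.all? (λ E → ¬? (Vec.≡-dec Bool._≟_ B E)) excluded ×-dec ¬? (oneSided? α B)

-- The hidden argument is filled by running the search over all subsets of `Fin k`, which replaces a
-- case analysis for concrete weights.
oneSided-unless : ∀ {k} (excluded : List (Subset k)) (τ : Fin k → ℤ) (α : Fin 4 → Fin k → ℤ) →
  {False (decided excluded τ α)} → ∀ B → total B τ ≡ + 0 → All (B ≢_) excluded → OneSided α B
oneSided-unless excluded τ α {none} B Bτ B≢ =
  decidable-stable (oneSided? α B) λ ¬os → toWitnessFalse none (B , Bτ , B≢ , ¬os)

-- The two obstructions: long cycles and claws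

module Obstructions (em : ExcludedMiddle 0ℓ) (ℝ : CompleteOrderedField) {n : ℕ} (G : Graph (Fin n)) where
  open Quadrilaterals em ℝ G using (AllSimplicial)

  -- The four arcs are three single vertices and the rest of the cycle. Modulo `τ`, the region where
  -- the forms of adjacent arcs are nonnegative is a cone over a square.
  cycle⇒¬simplicial : ∀ m (P : Fin (4 ℕ.+ m) → Fin n) → (∀ {i j} → P i ≡ P j → i ≡ j) →
    (∀ j → Adj G (P (inject₁ j)) (P (suc j))) → Adj G (P 0F) (P (fromℕ (3 ℕ.+ m))) → ¬ AllSimplicial
  cycle⇒¬simplicial m P P-injective consecutive closing = coloured-quadrilateral α
    (λ { 0F → ≡.refl ; 1F → ≡.refl ; 2F → ≡.refl ; 3F → ≡.refl })
    (λ B (u , u∈) _ Bτ → oneSided-unless (S false false false false ∷ []) τ α B Bτ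
      ((λ { ≡.refl → empty (block-member {S false false false false} ([]=⇒lookup u∈)) }) All.∷ All.[]))
    B (λ { 0F → ≡.refl ; 1F → ≡.refl ; 2F → ≡.refl ; 3F → ≡.refl }) connected
    (λ { 0F → ≡.refl ; 1F → ≡.refl ; 2F → ≡.refl ; 3F → ≡.refl })
    ≡.refl ≡.refl (λ ()) ≡.refl ≡.refl
    where
    c : Fin (4 ℕ.+ m) → Fin 4
    c 0F                  = 0F
    c 1F                  = 1F
    c 2F                  = 2F
    c (suc (suc (suc _))) = 3F

    rep : Fin 4 → Fin (4 ℕ.+ m)
    rep 0F = 0F
    rep 1F = 1F
    rep 2F = 2F
    rep 3F = 3F

    S : Bool → Bool → Bool → Bool → Subset 4
    S p q r s = p ∷ q ∷ r ∷ s ∷ []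

    -- Total zero leaves, besides the empty set, the pairs of adjacent arcs and the whole cycle.
    -- Opposite pairs get 2 or -2.
    τ : Fin 4 → ℤ
    τ = lookup (+ 1 ∷ -[1+ 0 ] ∷ + 1 ∷ -[1+ 0 ] ∷ [])

    -- On the blocks `B 0F`, ..., `B 3F` the corners take the values (0,1,0,1), (1,0,1,0),
    -- (0,1,1,0), (1,0,0,1): the rays of the cone over the square.
    α : Fin 4 → Fin 4 → ℤ
    α 0F = lookup (+ 0 ∷ + 0 ∷ + 0 ∷ + 1 ∷ [])
    α 1F = lookup (+ 0 ∷ + 1 ∷ + 0 ∷ + 0 ∷ [])
    α 2F = lookup (+ 0 ∷ + 0 ∷ + 1 ∷ + 0 ∷ [])
    α 3F = lookup (+ 0 ∷ + 1 ∷ -[1+ 0 ] ∷ + 1 ∷ [])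

    B : Fin 4 → Subset 4
    B 0F = S true true false false
    B 1F = S false false true true
    B 2F = S false true true false
    B 3F = S true false false true

    c-rep : ∀ i → c (rep i) ≡ i
    c-rep 0F = ≡.refl
    c-rep 1F = ≡.refl
    c-rep 2F = ≡.refl
    c-rep 3F = ≡.refl

    open Colourings em ℝ G P P-injective c rep c-rep τ

    empty : ∀ {u} → ¬ (∃ λ d → P d ≡ u × lookup (S false false false false) (c d) ≡ true)
    empty (d , _ , e) with c d
    empty (d , _ , ()) | 0F
    empty (d , _ , ()) | 1F
    empty (d , _ , ()) | 2F
    empty (d , _ , ()) | 3F

    Step : Subset 4 → Fin (4 ℕ.+ m) → Fin (4 ℕ.+ m) → Set
    Step B x y = Adj G (P x) (P y) × lookup B (c x) ≡ true × lookup B (c y) ≡ true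

    down : ∀ (j : Fin (suc m)) → Star (Step (B 1F)) (suc (suc (suc j))) 2F
    down = <-weakInduction _
      ((symm G (consecutive 2F) , ≡.refl , ≡.refl) ◅ ε)
      λ j path → (symm G (consecutive (suc (suc (suc j)))) , ≡.refl , ≡.refl) ◅ path

    -- The closing edge leads to the far end of the last arc, so these walks run upwards.
    up : ∀ (j : Fin (suc m)) → Star (Step (B 3F)) (suc (suc (suc j))) (fromℕ (3 ℕ.+ m))
    up = >-weakInduction _ ε λ j path → (consecutive (suc (suc (suc j))) , ≡.refl , ≡.refl) ◅ path

    connected : ∀ l → Nonempty (block (B l)) × Connected (G [ block (B l) ])
    connected 0F = block-connected (B 0F) 0F ≡.refl λ
      { 0F _ → ε
      ; 1F _ → (symm G (consecutive 0F) , ≡.refl , ≡.refl) ◅ ε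
      ; (suc (suc (suc _))) () }
    connected 1F = block-connected (B 1F) 2F ≡.refl λ
      { 2F _ → ε
      ; (suc (suc (suc j))) _ → down j }
    connected 2F = block-connected (B 2F) 1F ≡.refl λ
      { 1F _ → ε
      ; 2F _ → (symm G (consecutive 1F) , ≡.refl , ≡.refl) ◅ ε
      ; (suc (suc (suc _))) () }
    connected 3F = block-connected (B 3F) (fromℕ (3 ℕ.+ m)) ≡.refl λ
      { 0F _ → (closing , ≡.refl , ≡.refl) ◅ ε
      ; (suc (suc (suc j))) _ → up j }

  -- u₁ and u₂ form one class, v and u₃ one each. Only the form of the class of u₁, u₂ is not
  -- one-sided, and its block is disconnected; the union of that class with u₃ is one-sided, so it
  -- may be connected or not.
  claw⇒¬simplicial : ∀ {v u₁ u₂ u₃} → Adj G v u₁ → Adj G v u₂ → Adj G v u₃ →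
    u₁ ≢ u₂ → u₁ ≢ u₃ → u₂ ≢ u₃ → ¬ Adj G u₁ u₂ → ¬ AllSimplicial
  claw⇒¬simplicial {v} {u₁} {u₂} {u₃} vu₁ vu₂ vu₃ u₁≢u₂ u₁≢u₃ u₂≢u₃ ¬u₁u₂ = coloured-quadrilateral α
    (λ { 0F → ≡.refl ; 1F → ≡.refl ; 2F → ≡.refl })
    (λ B nonempty conn Bτ → oneSided-unless (S false false false ∷ S false true false ∷ []) τ α B Bτ
      ((λ { ≡.refl → empty (block-member {S false false false} ([]=⇒lookup (proj₂ nonempty))) })
        All.∷ (λ { ≡.refl → disconnected conn }) All.∷ All.[]))
    B (λ { 0F → ≡.refl ; 1F → ≡.refl ; 2F → ≡.refl ; 3F → ≡.refl }) connected
    (λ { 0F → ≡.refl ; 1F → ≡.refl ; 2F → ≡.refl })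
    ≡.refl ≡.refl (λ ()) ≡.refl ≡.refl
    where
    P : Fin 4 → Fin n
    P = corners v u₁ u₂ u₃

    P-injective : ∀ {d e} → P d ≡ P e → d ≡ e
    P-injective = corners-injective (adjacent⇒≢ G vu₁) (adjacent⇒≢ G vu₂) (adjacent⇒≢ G vu₃) u₁≢u₂ u₁≢u₃ u₂≢u₃

    c : Fin 4 → Fin 3
    c 0F = 0F
    c 1F = 1F
    c 2F = 1F
    c 3F = 2F

    rep : Fin 3 → Fin 4
    rep 0F = 0F
    rep 1F = 1F
    rep 2F = 3F

    S : Bool → Bool → Bool → Subset 3
    S p q r = p ∷ q ∷ r ∷ []

    -- With zero weights every union of classes is killed.
    τ : Fin 3 → ℤ
    τ = lookup (+ 0 ∷ + 0 ∷ + 0 ∷ [])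

    -- On `B 0F`, ..., `B 3F` the corners take the values (0,-1,0,-1), (1,0,1,0), (1,-1,0,0),
    -- (0,0,1,-1). The excluded form of u₁, u₂ takes the values 0, 0, 1, -1 at them: it would cut
    -- along the diagonal of the first two.
    α : Fin 4 → Fin 3 → ℤ
    α 0F = lookup (+ 0 ∷ + 0 ∷ -[1+ 0 ] ∷ [])
    α 1F = lookup (+ 1 ∷ + 0 ∷ -[1+ 0 ] ∷ [])
    α 2F = lookup (+ 0 ∷ + 1 ∷ -[1+ 0 ] ∷ [])
    α 3F = lookup (+ 1 ∷ -[1+ 0 ] ∷ -[1+ 0 ] ∷ [])

    B : Fin 4 → Subset 3
    B 0F = S true true false
    B 1F = S true false true
    B 2F = S true false false
    B 3F = S true true true

    c-rep : ∀ i → c (rep i) ≡ i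
    c-rep 0F = ≡.refl
    c-rep 1F = ≡.refl
    c-rep 2F = ≡.refl

    open Colourings em ℝ G P P-injective c rep c-rep τ

    empty : ∀ {u} → ¬ (∃ λ d → P d ≡ u × lookup (S false false false) (c d) ≡ true)
    empty (d , _ , e) with c d
    empty (d , _ , ()) | 0F
    empty (d , _ , ()) | 1F
    empty (d , _ , ()) | 2F

    star : ∀ B → lookup B 0F ≡ true → Nonempty (block B) × Connected (G [ block B ])
    star B v∈ = block-connected B 0F v∈ λ
      { 0F _  → ε
      ; 1F u∈ → (symm G vu₁ , u∈ , v∈) ◅ ε
      ; 2F u∈ → (symm G vu₂ , u∈ , v∈) ◅ ε
      ; 3F u∈ → (symm G vu₃ , u∈ , v∈) ◅ ε }

    connected : ∀ l → Nonempty (block (B l)) × Connected (G [ block (B l) ])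
    connected 0F = star (B 0F) ≡.refl
    connected 1F = star (B 1F) ≡.refl
    connected 2F = star (B 2F) ≡.refl
    connected 3F = star (B 3F) ≡.refl

    u₁∪u₂ : Subset n
    u₁∪u₂ = block (S false true false)

    disconnected : ¬ Connected (G [ u₁∪u₂ ])
    disconnected (_ , conn) = stuck (conn (u₁ , lookup⇒[]= u₁ _ (lookup-block-P (S false true false) 1F)) (u₂ , lookup⇒[]= u₂ _ (lookup-block-P (S false true false) 2F))) ≡.refl ≡.refl
      where
      stuck : ∀ {x y} → Star (Adj (G [ u₁∪u₂ ])) x y → proj₁ x ≡ u₁ → proj₁ y ≡ u₂ → ⊥
      stuck ε x≡u₁ x≡u₂ = u₁≢u₂ (≡.trans (≡.sym x≡u₁) x≡u₂)
      stuck (_◅_ {j = w , w∈} adj path) ≡.refl y≡u₂ with block-member {S false true false} ([]=⇒lookup w∈)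
      ... | 0F , _ , ()
      ... | 1F , u₁≡w , _ = irrefl G u₁≡w adj
      ... | 2F , ≡.refl , _ = ¬u₁u₂ adj
      ... | 3F , _ , ()

-- Graph theory

-- A longest path of G is all of G, as a vertex leaving it would extend it or have
-- degree three; likewise a chord closes a long cycle, creates degree three, or m = 2.
module LongestPaths (em : ExcludedMiddle 0ℓ) {n : ℕ} (G : Graph (Fin n)) (G-connected : Connected G)
  (no-claw : ∀ {v u₁ u₂ u₃} → Adj G v u₁ → Adj G v u₂ → Adj G v u₃ →
    u₁ ≢ u₂ → u₁ ≢ u₃ → u₂ ≢ u₃ → ¬ ¬ Adj G u₁ u₂)
  (no-cycle : ∀ m (P : Fin (4 ℕ.+ m) → Fin n) → (∀ {i j} → P i ≡ P j → i ≡ j) →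
    (∀ j → Adj G (P (inject₁ j)) (P (suc j))) → ¬ Adj G (P 0F) (P (fromℕ (3 ℕ.+ m)))) where

  -- Without claws u₁u₂ and u₂u₃ are edges, so v, u₁, u₂, u₃ is a cycle of length four.
  degree≤2 : ∀ {v u₁ u₂ u₃} → Adj G v u₁ → Adj G v u₂ → Adj G v u₃ →
    u₁ ≢ u₂ → u₁ ≢ u₃ → u₂ ≢ u₃ → ⊥
  degree≤2 {v} {u₁} {u₂} {u₃} vu₁ vu₂ vu₃ u₁≢u₂ u₁≢u₃ u₂≢u₃ = no-cycle 0 (corners v u₁ u₂ u₃)
    (corners-injective (adjacent⇒≢ G vu₁) (adjacent⇒≢ G vu₂) (adjacent⇒≢ G vu₃) u₁≢u₂ u₁≢u₃ u₂≢u₃)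
    (λ { 0F → vu₁
       ; 1F → decidable-stable em (no-claw vu₁ vu₂ vu₃ u₁≢u₂ u₁≢u₃ u₂≢u₃)
       ; 2F → decidable-stable em (no-claw vu₂ vu₃ vu₁ u₂≢u₃ (u₁≢u₂ ∘ ≡.sym) (u₁≢u₃ ∘ ≡.sym)) })
    vu₃

  -- Only the values P 0, …, P m are relevant.
  record PathTo (m : ℕ) (P : ℕ → Fin n) : Set where
    field
      injective   : ∀ {a b} → a ℕ.≤ m → b ℕ.≤ m → P a ≡ P b → a ≡ b
      consecutive : ∀ {a} → a ℕ.< m → Adj G (P a) (P (suc a))

  path-length : ∀ {m P} → PathTo m P → m ℕ.< n
  path-length {m} {P} path = Fin.injective⇒≤ {f = P ∘ toℕ {suc m}} λ {i} {j} e →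
    Fin.toℕ-injective (PathTo.injective path (Fin.toℕ≤pred[n] i) (Fin.toℕ≤pred[n] j) e)

  record Longest (m : ℕ) (P : ℕ → Fin n) : Set where
    field
      isPath  : PathTo m P
      longest : ∀ {Q} → ¬ PathTo (suc m) Q

  -- `fuel + m` stays at least `n`, whereas a path with `m` edges has `m < n`; so the fuel never
  -- runs out.
  longest-path : ∃ λ m → ∃ λ P → Longest m P
  longest-path = extend n 0 (λ _ → proj₁ G-connected)
    record { injective = λ { z≤n z≤n _ → ≡.refl } ; consecutive = λ () } (ℕ.≤-reflexive (≡.sym (ℕ.+-identityʳ n)))
    where
    extend : ∀ fuel m P → PathTo m P → n ℕ.≤ fuel ℕ.+ m → ∃ λ m → ∃ λ P → Longest m P
    extend zero m P path n≤m = contradiction n≤m (ℕ.<⇒≱ (path-length path))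
    extend (suc fuel) m P path n≤ with em {∃ λ Q → PathTo (suc m) Q}
    ... | yes (Q , longer) = extend fuel (suc m) Q longer (ℕ.≤-trans n≤ (ℕ.≤-reflexive (≡.sym (ℕ.+-suc fuel m))))
    ... | no  ∄longer      = m , P , record { isPath = path ; longest = λ longer → ∄longer (_ , longer) }

  reversed : ∀ {m P} → PathTo m P → PathTo m (λ a → P (m ∸ a))
  reversed {m} {P} path = record
    { injective   = λ {a} {b} a≤m b≤m e → ℕ.∸-cancelˡ-≡ a≤m b≤m (injective (ℕ.m∸n≤m m a) (ℕ.m∸n≤m m b) e)
    ; consecutive = λ {a} a<m → symm G (≡.subst (λ k → Adj G (P (m ∸ suc a)) (P k)) (≡.sym (ℕ.+-∸-assoc 1 a<m))
                      (consecutive (ℕ.≤-trans (ℕ.≤-reflexive (≡.sym (ℕ.+-∸-assoc 1 a<m))) (ℕ.m∸n≤m m a))))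
    }
    where open PathTo path

  prepended : ∀ {m P w} → PathTo m P → Adj G (P 0) w → (∀ {a} → a ℕ.≤ m → P a ≢ w) →
              PathTo (suc m) λ { zero → w ; (suc a) → P a }
  prepended path adj off = record
    { injective   = λ { {zero} {zero} _ _ _ → ≡.refl
                      ; {zero} {suc b} _ (s≤s b≤m) e → contradiction (≡.sym e) (off b≤m)
                      ; {suc a} {zero} (s≤s a≤m) _ e → contradiction e (off a≤m)
                      ; {suc a} {suc b} (s≤s a≤m) (s≤s b≤m) e → ≡.cong suc (PathTo.injective path a≤m b≤m e) }
    ; consecutive = λ { {zero} _ → symm G adj ; {suc a} (s≤s a<m) → PathTo.consecutive path a<m }
    }

  module _ {m : ℕ} {P : ℕ → Fin n} (is-longest : Longest m P) where
    open Longest is-longest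
    open PathTo isPath

    P-≢ : ∀ {a b} → a ℕ.≤ m → b ℕ.≤ m → a ≢ b → P a ≢ P b
    P-≢ a≤m b≤m a≢b e = a≢b (injective a≤m b≤m e)

    OnPath : Fin n → Set
    OnPath w = ∃ λ a → a ℕ.≤ m × P a ≡ w

    neighbour-on-path : ∀ {a w} → a ℕ.≤ m → Adj G (P a) w → OnPath w
    neighbour-on-path {a} {w} a≤m adj = decidable-stable em λ off →
      let off′ : ∀ {b} → b ℕ.≤ m → P b ≢ w
          off′ b≤m Pb≡w = off (_ , b≤m , Pb≡w)
      in impossible a a≤m adj off′ (ℕ.m≤n⇒m<n∨m≡n a≤m)
      where
      impossible : ∀ a → a ℕ.≤ m → Adj G (P a) w → (∀ {b} → b ℕ.≤ m → P b ≢ w) → a ℕ.< m ⊎ a ≡ m → ⊥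
      impossible zero    _   adj off _             = longest (prepended isPath adj off)
      impossible (suc a) _   adj off (inj₂ ≡.refl) = longest (prepended (reversed isPath) adj (λ {b} _ → off (ℕ.m∸n≤m m b)))
      impossible (suc a) a<m adj off (inj₁ 1+a<m)  = degree≤2 (symm G (consecutive a<m)) (consecutive 1+a<m) adj
        (P-≢ (ℕ.<⇒≤ a<m) 1+a<m (ℕ.<⇒≢ (ℕ.m<n⇒m<1+n (ℕ.n<1+n a)))) (off (ℕ.<⇒≤ a<m)) (off 1+a<m)

    on-path : ∀ w → OnPath w
    on-path w = along (proj₂ G-connected (P 0) w) (0 , z≤n , ≡.refl)
      where
      along : ∀ {x y} → Star (Adj G) x y → OnPath x → OnPath y
      along ε               on                   = on
      along (adj ◅ walk) (a , a≤m , ≡.refl) = along walk (neighbour-on-path a≤m adj)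

    position : Fin n ↔ Fin (suc m)
    position = mk↔ₛ′ (λ w → fromℕ< (s≤s (proj₁ (proj₂ (on-path w))))) (P ∘ toℕ)
      (λ i → Fin.toℕ-injective (injective (Fin.toℕ≤pred[n] _) (Fin.toℕ≤pred[n] i) (P-position (P (toℕ i)))))
      P-position
      where
      P-position : ∀ w → P (toℕ (fromℕ< (s≤s (proj₁ (proj₂ (on-path w)))))) ≡ w
      P-position w = ≡.trans (≡.cong P (Fin.toℕ-fromℕ< _)) (proj₂ (proj₂ (on-path w)))

    to-position : Fin n → Fin (suc m)
    to-position = Inverse.to position

    P-to-position : ∀ w → P (toℕ (to-position w)) ≡ w
    P-to-position w = Inverse.strictlyInverseʳ position w

    -- `d + 2` is the distance along the path: `d = 0` closes a triangle, and larger `d` a cycle of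
    -- length at least four.
    Chord : Set
    Chord = ∃ λ a → ∃ λ d → 2 ℕ.+ d ℕ.+ a ℕ.≤ m × Adj G (P a) (P (2 ℕ.+ d ℕ.+ a))

    chord⇒m≡2 : Chord → m ≡ 2 × Adj G (P 0) (P 2)
    chord⇒m≡2 (a , suc d , b≤m , adj) = ⊥-elim (no-cycle d (λ i → P (toℕ i ℕ.+ a))
      (λ {i} {j} e → Fin.toℕ-injective (ℕ.+-cancelʳ-≡ a _ _ (injective (bound i) (bound j) e)))
      (λ j → ≡.subst (λ k → Adj G (P (k ℕ.+ a)) (P (suc (toℕ j) ℕ.+ a))) (≡.sym (Fin.toℕ-inject₁ j))
        (consecutive (bound (suc j))))
      (≡.subst (λ k → Adj G (P a) (P (k ℕ.+ a))) (≡.sym (Fin.toℕ-fromℕ (3 ℕ.+ d))) adj))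
      where
      bound : ∀ (i : Fin (4 ℕ.+ d)) → toℕ i ℕ.+ a ℕ.≤ m
      bound i = ℕ.≤-trans (ℕ.+-monoˡ-≤ a (Fin.toℕ≤pred[n] i)) b≤m
    -- `P (1 + a)` is adjacent to `P a`, `P (2 + a)` and `P (3 + a)`.
    chord⇒m≡2 (suc a , zero , b≤m , adj) = ⊥-elim (degree≤2
      (symm G (consecutive (ℕ.<⇒≤ (ℕ.<⇒≤ b≤m)))) (consecutive (ℕ.<⇒≤ b≤m)) adj
      (P-≢ (ℕ.<⇒≤ (ℕ.<⇒≤ (ℕ.<⇒≤ b≤m))) (ℕ.<⇒≤ b≤m) λ ())
      (P-≢ (ℕ.<⇒≤ (ℕ.<⇒≤ (ℕ.<⇒≤ b≤m))) b≤m λ ())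
      (P-≢ (ℕ.<⇒≤ b≤m) b≤m λ ()))
    chord⇒m≡2 (zero , zero , b≤m , adj) with ℕ.m≤n⇒m<n∨m≡n b≤m
    ... | inj₂ ≡.refl = ≡.refl , adj
    -- `P 2` is adjacent to `P 0`, `P 1` and `P 3`.
    ... | inj₁ 2<m    = ⊥-elim (degree≤2 (symm G adj) (symm G (consecutive b≤m)) (consecutive 2<m)
      (P-≢ z≤n (ℕ.<⇒≤ b≤m) λ ()) (P-≢ z≤n 2<m λ ()) (P-≢ (ℕ.<⇒≤ b≤m) 2<m λ ()))

    far-apart⇒chord : ∀ {a b} → suc a ℕ.< b → b ℕ.≤ m → Adj G (P a) (P b) → Chord
    far-apart⇒chord {a} {b} 1+a<b b≤m adj = a , b ∸ (2 ℕ.+ a) , ℕ.≤-trans (ℕ.≤-reflexive eq) b≤m ,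
      ≡.subst (λ k → Adj G (P a) (P k)) (≡.sym eq) adj
      where
      eq : 2 ℕ.+ (b ∸ (2 ℕ.+ a)) ℕ.+ a ≡ b
      eq = ≡.trans (≡.cong (ℕ._+ a) (ℕ.+-comm 2 (b ∸ (2 ℕ.+ a))))
             (≡.trans (ℕ.+-assoc (b ∸ (2 ℕ.+ a)) 2 a) (ℕ.m∸n+n≡m 1+a<b))

    chordless⇒path : ¬ Chord → IsPath G
    chordless⇒path chordless = suc m , record
      { vertices = position
      ; adjacent = λ u v → mk⇔
          (λ adj → neighbours (Fin.toℕ≤pred[n] (to-position u)) (Fin.toℕ≤pred[n] (to-position v))
            (≡.subst₂ (Adj G) (≡.sym (P-to-position u)) (≡.sym (P-to-position v)) adj))
          (λ e → ≡.subst₂ (Adj G) (P-to-position u) (P-to-position v)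
            ([ (λ e → step (to-position u) (to-position v) e) , (λ e → symm G (step (to-position v) (to-position u) e)) ]′ e))
      }
      where
      neighbours : ∀ {a b} → a ℕ.≤ m → b ℕ.≤ m → Adj G (P a) (P b) → suc a ≡ b ⊎ suc b ≡ a
      neighbours {a} {b} a≤m b≤m adj with ℕ.<-cmp a b
      ... | tri< a<b _ _ = inj₁ ([ (λ 1+a<b → contradiction (far-apart⇒chord 1+a<b b≤m adj) chordless) , (λ e → e) ]′ (ℕ.m≤n⇒m<n∨m≡n a<b))
      ... | tri≈ _ ≡.refl _ = contradiction adj (irrefl G ≡.refl)
      ... | tri> _ _ b<a = inj₂ ([ (λ 1+b<a → contradiction (far-apart⇒chord 1+b<a a≤m (symm G adj)) chordless) , (λ e → e) ]′ (ℕ.m≤n⇒m<n∨m≡n b<a))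

      step : ∀ (i j : Fin (suc m)) → suc (toℕ i) ≡ toℕ j → Adj G (P (toℕ i)) (P (toℕ j))
      step i j e = ≡.subst (λ k → Adj G (P (toℕ i)) (P k)) e
        (consecutive (ℕ.≤-trans (ℕ.≤-reflexive e) (Fin.toℕ≤pred[n] j)))

  triangle-or-path : IsTriangle G ⊎ IsPath G
  triangle-or-path with longest-path
  ... | m , P , longest with em {Chord longest}
  ...   | no  chordless = inj₂ (chordless⇒path longest chordless)
  ...   | yes chord with chord⇒m≡2 longest chord
  ...     | ≡.refl , P₀P₂ = inj₁ record
    { vertices = position longest
    ; adjacent = λ u v → mk⇔
        (λ adj e → irrefl G (≡.trans (≡.sym (P-to-position longest u)) (≡.trans (≡.cong (P ∘ toℕ) e) (P-to-position longest v))) adj)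
        (λ ≢ → ≡.subst₂ (Adj G) (P-to-position longest u) (P-to-position longest v) (complete _ _ ≢))
    }
    where
    P₀P₁ = PathTo.consecutive (Longest.isPath longest) {0} (s≤s z≤n)
    P₁P₂ = PathTo.consecutive (Longest.isPath longest) {1} (s≤s (s≤s z≤n))
    complete : ∀ (i j : Fin 3) → i ≢ j → Adj G (P (toℕ i)) (P (toℕ j))
    complete 0F 0F ≢ = contradiction ≡.refl ≢
    complete 0F 1F _ = P₀P₁
    complete 0F 2F _ = P₀P₂
    complete 1F 0F _ = symm G P₀P₁
    complete 1F 1F ≢ = contradiction ≡.refl ≢
    complete 1F 2F _ = P₁P₂
    complete 2F 0F _ = symm G P₀P₂
    complete 2F 1F _ = symm G P₁P₂
    complete 2F 2F ≢ = contradiction ≡.refl ≢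

-- Paths

-- Half-open, with end points in `Fin (suc n)`, so that `a` and `b` serve as indices of prefix sums.
record Interval {n} (s : Fin n → Bool) (a b : Fin (suc n)) : Set where
  field
    range : ∀ {i} → s i ≡ true → toℕ a ℕ.≤ toℕ i × toℕ i ℕ.< toℕ b
    full  : ∀ {i} → toℕ a ℕ.≤ toℕ i → toℕ i ℕ.< toℕ b → s i ≡ true

downset⇒interval : ∀ {n} (s : Fin n → Bool) →
  (∀ {i j} → toℕ i ℕ.≤ toℕ j → s j ≡ true → s i ≡ true) → ∃ (Interval s zero)
downset⇒interval {zero}  s down = zero , record { range = λ { {()} } ; full = λ { {()} } }
downset⇒interval {suc n} s down with s zero in s0
... | false = zero , record
  { range = λ si → contradiction (≡.trans (≡.sym s0) (down z≤n si)) λ ()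
  ; full  = λ _ () }
... | true with b , tail ← downset⇒interval (s ∘ suc) (λ i≤j → down (s≤s i≤j)) = suc b , record
  { range = λ { {zero} _ → z≤n , s≤s z≤n ; {suc i} si → z≤n , s≤s (proj₂ (Interval.range tail si)) }
  ; full  = λ { {zero} _ _ → s0 ; {suc i} _ (s≤s i<b) → Interval.full tail z≤n i<b } }

-- Positions before the first member are skipped; from there on, convexity makes the rest a
-- down-set.
convex⇒interval : ∀ {n} (s : Fin n → Bool) →
  (∀ {i k j} → toℕ i ℕ.≤ toℕ k → toℕ k ℕ.≤ toℕ j → s i ≡ true → s j ≡ true → s k ≡ true) →
  ∀ i → s i ≡ true → ∃ λ a → ∃ λ b → toℕ a ℕ.< toℕ b × Interval s a b
convex⇒interval {suc n} s convex i si with s zero in s0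
... | true with b , int ← downset⇒interval s (λ i≤j sj → convex z≤n i≤j s0 sj) =
  zero , b , proj₂ (Interval.range int s0) , int
convex⇒interval {suc n} s convex zero    si | false = contradiction (≡.trans (≡.sym s0) si) λ ()
convex⇒interval {suc n} s convex (suc i) si | false
  with a , b , a<b , tail ← convex⇒interval (s ∘ suc) (λ i≤k k≤j → convex (s≤s i≤k) (s≤s k≤j)) i si
  = suc a , suc b , s≤s a<b , record
  { range = λ { {zero} s0′ → contradiction (≡.trans (≡.sym s0) s0′) λ ()
              ; {suc i} si → s≤s (proj₁ (Interval.range tail si)) , s≤s (proj₂ (Interval.range tail si)) }
  ; full  = λ { {suc i} (s≤s a≤i) (s≤s i<b) → Interval.full tail a≤i i<b } }

module PrefixSums (em : ExcludedMiddle 0ℓ) (ℝ : CompleteOrderedField) where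
  open OrderedField ℝ
  open Topology em ℝ
  open SimplicialCones em ℝ
  open SemiringSum semiring using (sum)

  strict-minimum : ∀ {n} (y : Fin (suc n) → Carrier) → (∀ {i j} → i ≢ j → ¬ y i ≈ y j) →
                   ∃ λ m → ∀ {i} → m ≢ i → y m < y i
  strict-minimum {zero} y distinct = zero , λ { {zero} 0≢0 → contradiction ≡.refl 0≢0 }
  strict-minimum {suc n} y distinct
    with m , least ← strict-minimum (y ∘ suc) (λ i≢j → distinct (i≢j ∘ Fin.suc-injective))
    with compare (y zero) (y (suc m))
  ... | tri< 0<m _ _ = zero , λ
    { {zero} 0≢0 → contradiction ≡.refl 0≢0
    ; {suc i} _ → [ (λ m≢i → <-trans 0<m (least m≢i)) , (λ m≡i → ≡.subst (λ i → y zero < y (suc i)) m≡i 0<m) ]′ (≢-or-≡ m i) }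
    where
    ≢-or-≡ : ∀ {n} (i j : Fin n) → i ≢ j ⊎ i ≡ j
    ≢-or-≡ i j with i Fin.≟ j
    ... | yes i≡j = inj₂ i≡j
    ... | no  i≢j = inj₁ i≢j
  ... | tri≈ _ 0≈m _ = contradiction 0≈m (distinct λ ())
  ... | tri> _ _ m<0 = suc m , λ
    { {zero} _ → m<0
    ; {suc i} m≢i → least (m≢i ∘ ≡.cong suc) }

  -- Selection sort: the minimum comes first, and the permutation that sorts the remaining values is
  -- extended by it.
  sort : ∀ {n} (y : Fin n → Carrier) → (∀ {i j} → i ≢ j → ¬ y i ≈ y j) →
         ∃ λ (σ : Permutation′ n) → ∀ {i j} → toℕ i ℕ.< toℕ j → y (σ ⟨$⟩ʳ i) < y (σ ⟨$⟩ʳ j)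
  sort {zero}  y distinct = Perm.id , λ { {()} }
  sort {suc n} y distinct
    with m , least ← strict-minimum y distinct
    with σ , sorted ← sort (y ∘ punchIn m) (λ i≢j → distinct (i≢j ∘ Fin.punchIn-injective m _ _))
    = Perm.insert zero m σ , λ
      { {zero} {suc j} _ → least (Fin.punchInᵢ≢i m (σ ⟨$⟩ʳ j) ∘ ≡.sym ∘ λ e → ≡.trans e (Perm.insert-punchIn zero m σ j))
      ; {suc i} {suc j} (s≤s i<j) → ≡.subst₂ (λ u v → y u < y v)
          (≡.sym (Perm.insert-punchIn zero m σ i)) (≡.sym (Perm.insert-punchIn zero m σ j)) (sorted i<j) }

  increasing : ∀ {n} (w : Fin (suc n) → Carrier) → (∀ k → w (inject₁ k) < w (suc k)) →
               ∀ {i j} → toℕ i ℕ.< toℕ j → w i < w j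
  increasing {suc n} w step {zero}  {suc zero}    _         = step zero
  increasing {suc n} w step {zero}  {suc (suc j)} _         =
    <-trans (step zero) (increasing (w ∘ suc) (step ∘ suc) {zero} {suc j} (s≤s z≤n))
  increasing {suc n} w step {suc i} {suc j}       (s≤s i<j) = increasing (w ∘ suc) (step ∘ suc) i<j

  swap-differences : ∀ a b c d → (a - b) * (c - d) ≈ (b - a) * (d - c)
  swap-differences = solve 4 (λ a b c d → (a :- b) :* (c :- d) := (b :- a) :* (d :- c)) refl

  co-sorted : ∀ {n} (y z : Fin n → Carrier) →
    (∀ {i j} → toℕ i ℕ.< toℕ j → y i < y j) → (∀ {i j} → toℕ i ℕ.< toℕ j → z i < z j) →
    ∀ {i j} → i ≢ j → 0# < (y j - y i) * (z j - z i)
  co-sorted y z y-sorted z-sorted {i} {j} i≢j with ℕ.<-cmp (toℕ i) (toℕ j)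
  ... | tri< i<j _ _ = *-pos (0<y-x (y-sorted i<j)) (0<y-x (z-sorted i<j))
  ... | tri≈ _ i≡j _ = contradiction (Fin.toℕ-injective i≡j) i≢j
  ... | tri> _ _ j<i = <-respʳ (swap-differences (y i) (y j) (z i) (z j))
    (*-pos (0<y-x (y-sorted j<i)) (0<y-x (z-sorted j<i)))

  -- The empty prefix is included, so that initial intervals too are differences of two of the
  -- `n + 1` sums. In terms of these sums the path arrangement is the braid arrangement.
  prefix : ∀ {n} → Point ℝ n → Fin (suc n) → Carrier
  prefix         x zero    = 0#
  prefix {suc n} x (suc k) = x zero + prefix (x ∘ suc) k

  differences : ∀ {n} → (Fin (suc n) → Carrier) → Point ℝ n
  differences y k = y (suc k) - y (inject₁ k)

  prefix-linear : ∀ {n} k → IsLinearForm {n} (λ x → prefix x k)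
  prefix-linear k = record { cong = cong k ; +*-homo = homo k }
    where
    cong : ∀ {n} k {x y : Point ℝ n} → x ≈ₚ y → prefix x k ≈ prefix y k
    cong         zero    x≈y = refl
    cong {suc n} (suc k) x≈y = +-cong (x≈y zero) (cong k (x≈y ∘ suc))
    homo : ∀ {n} k (x : Point ℝ n) t y → prefix (x +[ t ] y) k ≈ prefix x k + t * prefix y k
    homo         zero    x t y = solve 1 (λ t → :0 := :0 :+ t :* :0) refl t
    homo {suc n} (suc k) x t y = trans (+-congˡ (homo k (x ∘ suc) t (y ∘ suc)))
      (solve 5 (λ a t b p q → a :+ t :* b :+ (p :+ t :* q) := a :+ p :+ t :* (b :+ q)) refl
        (x zero) t (y zero) (prefix (x ∘ suc) k) (prefix (y ∘ suc) k))

  differences∘prefix : ∀ {n} (x : Point ℝ n) → differences (prefix x) ≈ₚ x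
  differences∘prefix {suc n} x zero    = solve 1 (λ a → a :+ :0 :- :0 := a) refl (x zero)
  differences∘prefix {suc n} x (suc k) = trans
    (solve 3 (λ a p q → a :+ p :- (a :+ q) := p :- q) refl (x zero) (prefix (x ∘ suc) (suc k)) (prefix (x ∘ suc) (inject₁ k)))
    (differences∘prefix (x ∘ suc) k)

  prefix∘differences : ∀ {n} (y : Fin (suc n) → Carrier) k → prefix (differences y) k ≈ y k - y zero
  prefix∘differences         y zero    = sym (-‿inverseʳ (y zero))
  prefix∘differences {suc n} y (suc k) = trans (+-congˡ (prefix∘differences (y ∘ suc) k))
    (solve 3 (λ a b c → b :- a :+ (c :- b) := c :- a) refl (y zero) (y (suc zero)) (y (suc k)))

  -- The simple roots of the chamber of the braid arrangement that belongs to the order `σ`.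
  rearranged : ∀ {n} → (Fin (suc n) → Fin (suc n)) → Point ℝ n → Point ℝ n
  rearranged σ x = differences (prefix x ∘ σ)

  rearranged-linear : ∀ {n} (σ : Fin (suc n) → Fin (suc n)) k → IsLinearForm (λ x → rearranged σ x k)
  rearranged-linear σ k = record
    { cong    = λ x≈y → +-cong (IsLinearForm.cong (prefix-linear (σ (suc k))) x≈y)
                               (-‿cong (IsLinearForm.cong (prefix-linear (σ (inject₁ k))) x≈y))
    ; +*-homo = λ x t y → trans (+-cong (IsLinearForm.+*-homo (prefix-linear (σ (suc k))) x t y)
                                        (-‿cong (IsLinearForm.+*-homo (prefix-linear (σ (inject₁ k))) x t y)))
        (solve 5 (λ a b c d t → a :+ t :* b :- (c :+ t :* d) := a :- c :+ t :* (b :- d)) refl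
          (prefix x (σ (suc k))) (prefix y (σ (suc k))) (prefix x (σ (inject₁ k))) (prefix y (σ (inject₁ k))) t)
    }

  -- Subtracting y zero in prefix∘differences shifts all prefix sums alike, so differences do not see it.
  rearranged-inverse : ∀ {n} (σ ρ : Fin (suc n) → Fin (suc n)) → (∀ i → ρ (σ i) ≡ i) →
                       ∀ (x : Point ℝ n) → rearranged σ (rearranged ρ x) ≈ₚ x
  rearranged-inverse σ ρ ρσ x k = begin
    prefix (rearranged ρ x) (σ (suc k)) - prefix (rearranged ρ x) (σ (inject₁ k))
      ≈⟨ +-cong (prefix∘differences (prefix x ∘ ρ) (σ (suc k))) (-‿cong (prefix∘differences (prefix x ∘ ρ) (σ (inject₁ k)))) ⟩
    (prefix x (ρ (σ (suc k))) - c) - (prefix x (ρ (σ (inject₁ k))) - c)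
      ≈⟨ solve 3 (λ a b c → (a :- c) :- (b :- c) := a :- b) refl _ _ c ⟩
    prefix x (ρ (σ (suc k))) - prefix x (ρ (σ (inject₁ k)))
      ≈⟨ reflexive (≡.cong₂ (λ i j → prefix x i - prefix x j) (ρσ (suc k)) (ρσ (inject₁ k))) ⟩
    prefix x (suc k) - prefix x (inject₁ k)
      ≈⟨ differences∘prefix x k ⟩
    x k ∎
    where
    open SetoidReasoning setoid
    c = prefix x (ρ zero)

  interval-sum : ∀ {n} (s : Fin n → Bool) a b → toℕ a ℕ.≤ toℕ b → Interval s a b →
                 ∀ x → sum (λ i → if s i then x i else 0#) ≈ prefix x b - prefix x a
  interval-sum s zero zero _ int x = trans (sum-zero outside-all) (sym (-‿inverseʳ 0#))
    where
    outside-all : ∀ i → (if s i then x i else 0#) ≈ 0#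
    outside-all i with s i in si
    ... | false = refl
    ... | true with () ← proj₂ (Interval.range int si)
  interval-sum {suc n} s zero (suc b) _ int x rewrite Interval.full int {zero} z≤n (s≤s z≤n) =
    trans (+-congˡ (interval-sum (s ∘ suc) zero b z≤n tail (x ∘ suc)))
      (solve 2 (λ a p → a :+ (p :- :0) := a :+ p :- :0) refl (x zero) (prefix (x ∘ suc) b))
    where
    tail : Interval (s ∘ suc) zero b
    tail = record { range = λ si → z≤n , ℕ.s≤s⁻¹ (proj₂ (Interval.range int si)) ; full = λ _ i<b → Interval.full int z≤n (s≤s i<b) }
  interval-sum {suc n} s (suc a) (suc b) (s≤s a≤b) int x with s zero in s0
  ... | true with () ← proj₁ (Interval.range int s0)
  ... | false = trans (+-identityˡ _) (trans (interval-sum (s ∘ suc) a b a≤b tail (x ∘ suc))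
      (solve 3 (λ a p q → p :- q := a :+ p :- (a :+ q)) refl (x zero) (prefix (x ∘ suc) b) (prefix (x ∘ suc) a)))
    where
    tail : Interval (s ∘ suc) a b
    tail = record
      { range = λ si → let (p , q) = Interval.range int si in ℕ.s≤s⁻¹ p , ℕ.s≤s⁻¹ q
      ; full  = λ a≤i i<b → Interval.full int (s≤s a≤i) (s≤s i<b) }

module PathArrangement (em : ExcludedMiddle 0ℓ) (ℝ : CompleteOrderedField) {n : ℕ} (G : Graph (Fin n))
  (iso : G ≅ path n) where
  open OrderedField ℝ
  open Topology em ℝ
  open SimplicialCones em ℝ
  open GenericPoints em ℝ
  open PrefixSums em ℝ
  open Quadrilaterals em ℝ G
  open SemiringSum semiring using (sum-permute)
  open _≅_ iso
  open Inverse vertices using (to; from; strictlyInverseˡ; strictlyInverseʳ)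

  bits : Subset n → Fin n → Bool
  bits I i = lookup I (from i)

  prefixes : Point ℝ n → Fin (suc n) → Carrier
  prefixes x = prefix (x ∘ from)

  F-interval : ∀ (I : Subset n) {a b} → toℕ a ℕ.≤ toℕ b → Interval (bits I) a b →
               ∀ x → F I x ≈ prefixes x b - prefixes x a
  F-interval I {a} {b} a≤b int x =
    trans (sum-permute (λ u → if lookup I u then x u else 0#) (Perm.flip vertices))
          (interval-sum (bits I) a b a≤b int (x ∘ from))

  -- Each step of a walk in `G [ I ]` changes the position on the path by one, so the walk cannot
  -- jump over `k`.
  convex : ∀ {I : Subset n} → Connected (G [ I ]) →
    ∀ {i k j} → toℕ i ℕ.≤ toℕ k → toℕ k ℕ.≤ toℕ j → bits I i ≡ true → bits I j ≡ true → bits I k ≡ true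
  convex {I} (_ , connected) {i} {k} {j} i≤k k≤j i∈ j∈ =
    between (connected (from i , lookup⇒[]= (from i) I i∈) (from j , lookup⇒[]= (from j) I j∈))
      (≡.subst (λ h → toℕ h ℕ.≤ toℕ k) (≡.sym (strictlyInverseˡ i)) i≤k)
      (≡.subst (λ h → toℕ k ℕ.≤ toℕ h) (≡.sym (strictlyInverseˡ j)) k≤j)
    where
    reached : ∀ (u : Σ (Fin n) (λ u → I Vec.[ u ]= true)) → toℕ (to (proj₁ u)) ≡ toℕ k → bits I k ≡ true
    reached (u , u∈) e =
      ≡.trans (≡.cong (bits I) (≡.sym (Fin.toℕ-injective e))) (≡.trans (≡.cong (lookup I) (strictlyInverseʳ u)) ([]=⇒lookup u∈))

    between : ∀ {u v} → Star (Adj (G [ I ])) u v → toℕ (to (proj₁ u)) ℕ.≤ toℕ k → toℕ k ℕ.≤ toℕ (to (proj₁ v)) → bits I k ≡ true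
    between {u} ε u≤k k≤u = reached u (ℕ.≤-antisym u≤k k≤u)
    between {u} (_◅_ {j = w} adj walk) u≤k k≤v with ℕ.m≤n⇒m<n∨m≡n u≤k
    ... | inj₂ u≡k = reached u u≡k
    ... | inj₁ u<k = between {w} walk
      ([ (λ e → ≡.subst (ℕ._≤ toℕ k) e u<k)
       , (λ e → ℕ.≤-trans (ℕ.n≤1+n _) (≡.subst (ℕ._≤ toℕ k) (≡.sym e) u≤k)) ]′
         (Equivalence.to (adjacent (proj₁ u) (proj₁ w)) adj)) k≤v

  index⇒interval : ∀ (J : Index) → ∃ λ a → ∃ λ b → toℕ a ℕ.< toℕ b × (∀ x → F (proj₁ J) x ≈ prefixes x b - prefixes x a)
  index⇒interval (I , (u , u∈) , connected)
    with a , b , a<b , int ← convex⇒interval (bits I) (convex connected) (to u)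
           (≡.trans (≡.cong (lookup I) (strictlyInverseʳ u)) ([]=⇒lookup u∈))
    = a , b , a<b , F-interval I (ℕ.<⇒≤ a<b) int

  module _ {a b : Fin (suc n)} (a<b : toℕ a ℕ.< toℕ b) where

    inRange? : ∀ (i : Fin n) → Dec (toℕ a ℕ.≤ toℕ i × toℕ i ℕ.< toℕ b)
    inRange? i = (toℕ a ℕ.≤? toℕ i) ×-dec (toℕ i ℕ.<? toℕ b)

    I : Subset n
    I = tabulate (does ∘ inRange? ∘ to)

    inRange⇒member : ∀ u → toℕ a ℕ.≤ toℕ (to u) → toℕ (to u) ℕ.< toℕ b → I Vec.[ u ]= true
    inRange⇒member u a≤u u<b = lookup⇒[]= u I (≡.trans (lookup∘tabulate _ u) (dec-true (inRange? (to u)) (a≤u , u<b)))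

    member⇒inRange : ∀ {u} → I Vec.[ u ]= true → toℕ a ℕ.≤ toℕ (to u) × toℕ (to u) ℕ.< toℕ b
    member⇒inRange {u} u∈ = from-does (inRange? (to u)) (≡.trans (≡.sym (lookup∘tabulate _ u)) ([]=⇒lookup u∈))
      where
      from-does : ∀ {A : Set} (A? : Dec A) → does A? ≡ true → A
      from-does (yes x) _ = x

    I-interval : Interval (bits I) a b
    I-interval = record
      { range = λ {i} i∈ → ≡.subst (λ h → toℕ a ℕ.≤ toℕ h × toℕ h ℕ.< toℕ b) (strictlyInverseˡ i)
                  (member⇒inRange (lookup⇒[]= (from i) I i∈))
      ; full  = λ {i} a≤i i<b → []=⇒lookup (inRange⇒member (from i)
                  (≡.subst (λ h → toℕ a ℕ.≤ toℕ h) (≡.sym (strictlyInverseˡ i)) a≤i)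
                  (≡.subst (λ h → toℕ h ℕ.< toℕ b) (≡.sym (strictlyInverseˡ i)) i<b)) }

    b≤n : toℕ b ℕ.≤ n
    b≤n = Fin.toℕ≤pred[n] b

    vertex : ∀ {i} → i ℕ.< n → Fin n
    vertex i<n = from (fromℕ< i<n)

    to-vertex : ∀ {i} (i<n : i ℕ.< n) → toℕ (to (vertex i<n)) ≡ i
    to-vertex i<n = ≡.trans (≡.cong toℕ (strictlyInverseˡ (fromℕ< i<n))) (Fin.toℕ-fromℕ< i<n)

    first : Σ (Fin n) (λ u → I Vec.[ u ]= true)
    first = u , inRange⇒member u (ℕ.≤-reflexive (≡.sym (to-vertex a<n))) (≡.subst (ℕ._< toℕ b) (≡.sym (to-vertex a<n)) a<b)
      where
      a<n = ℕ.<-≤-trans a<b b≤n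
      u = vertex a<n

    -- `d` is the distance of `u` from the first vertex of the interval; each step moves to the
    -- preceding position.
    descend : ∀ d u (u∈ : I Vec.[ u ]= true) → toℕ (to u) ≡ d ℕ.+ toℕ a → Star (Adj (G [ I ])) (u , u∈) first
    descend zero u u∈ e = stay (≡.trans (≡.sym (strictlyInverseʳ u)) (≡.trans
        (≡.cong from (Fin.toℕ-injective (≡.trans e (≡.sym (to-vertex (ℕ.<-≤-trans a<b b≤n))))))
        (strictlyInverseʳ (proj₁ first))))
      where
      stay : u ≡ proj₁ first → Star (Adj (G [ I ])) (u , u∈) first
      stay ≡.refl with ≡.refl ← []=-irrelevant u∈ (proj₂ first) = ε
    descend (suc d) u u∈ e = Equivalence.from (adjacent u w) (inj₂ (≡.trans (≡.cong suc (to-vertex w<n)) (≡.sym e)))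
      ◅ descend d w w∈ (to-vertex w<n)
      where
      w<u : d ℕ.+ toℕ a ℕ.< toℕ (to u)
      w<u = ℕ.≤-reflexive (≡.sym e)
      w<n = ℕ.<-trans w<u (Fin.toℕ<n (to u))
      w = vertex w<n
      w∈ = inRange⇒member w (≡.subst (toℕ a ℕ.≤_) (≡.sym (to-vertex w<n)) (ℕ.m≤n+m (toℕ a) d))
        (≡.subst (ℕ._< toℕ b) (≡.sym (to-vertex w<n)) (ℕ.<-trans w<u (proj₂ (member⇒inRange u∈))))

    interval⇒index : Index
    interval⇒index = I , first , first , λ u v → to-first u ◅◅ reverse (symm G) (to-first v)
      where
      to-first : ∀ u → Star (Adj (G [ I ])) u first
      to-first (u , u∈) = descend (toℕ (to u) ∸ toℕ a) u u∈ (≡.sym (ℕ.m∸n+n≡m (proj₁ (member⇒inRange u∈))))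

    F-interval⇒index : ∀ x → F I x ≈ prefixes x b - prefixes x a
    F-interval⇒index = F-interval I (ℕ.<⇒≤ a<b) I-interval

  -- Every two prefix sums are compared by some hyperplane, since every nonempty interval is
  -- connected; exchanging `a` and `b` negates both factors.
  separated : ∀ {p x} → Cell p x → ∀ {a b} → a ≢ b →
              0# < (prefixes p b - prefixes p a) * (prefixes x b - prefixes x a)
  separated {p} {x} px {a} {b} a≢b with ℕ.<-cmp (toℕ a) (toℕ b)
  ... | tri≈ _ a≡b _ = contradiction (Fin.toℕ-injective a≡b) a≢b
  ... | tri< a<b _ _ = <-respʳ (*-cong (F-interval⇒index a<b p) (F-interval⇒index a<b x)) (px (interval⇒index a<b))
  ... | tri> _ _ b<a = <-respʳ
    (trans (*-cong (F-interval⇒index b<a p) (F-interval⇒index b<a x))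
      (swap-differences (prefixes p a) (prefixes p b) (prefixes x a) (prefixes x b)))
    (px (interval⇒index b<a))

  -- `σ` sorts the prefix sums of `p`. If those of `x` increase between neighbours in this order,
  -- they increase throughout, so all differences of two sums, which are the forms, have the same
  -- sign at `x` as at `p`.
  path-simplicial : AllSimplicial
  path-simplicial p p∉ = coordinates⇒simplicial L M L-cong (λ u → rearranged-linear τ (to u)) LM ML p
    (λ k → <⇒≉ (0<Lp k) ∘ sym) λ x → mk⇔ (cell⇒L x) (L⇒cell x)
    where
    distinct : ∀ {a b} → a ≢ b → ¬ prefixes p a ≈ prefixes p b
    distinct {a} {b} a≢b e = 0<*⇒≉0ˡ (separated (self-in-cell p∉) (a≢b ∘ ≡.sym)) (trans (+-congʳ e) (-‿inverseʳ (prefixes p b)))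

    sorting = sort (prefixes p) distinct
    σ τ : Fin (suc n) → Fin (suc n)
    σ = proj₁ sorting ⟨$⟩ʳ_
    τ = proj₁ sorting ⟨$⟩ˡ_

    sorted : ∀ {i j} → toℕ i ℕ.< toℕ j → prefixes p (σ i) < prefixes p (σ j)
    sorted = proj₂ sorting

    σ-injective : ∀ {i j} → σ i ≡ σ j → i ≡ j
    σ-injective e = ≡.trans (≡.sym (Perm.inverseˡ (proj₁ sorting))) (≡.trans (≡.cong τ e) (Perm.inverseˡ (proj₁ sorting)))

    L M : Point ℝ n → Point ℝ n
    L x = rearranged σ (x ∘ from)
    M c = rearranged τ c ∘ to

    L-cong : ∀ {x y} → x ≈ₚ y → L x ≈ₚ L y
    L-cong x≈y k = IsLinearForm.cong (rearranged-linear σ k) (x≈y ∘ from)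

    LM : ∀ c → L (M c) ≈ₚ c
    LM c k = trans
      (IsLinearForm.cong (rearranged-linear σ k) λ i → reflexive (≡.cong (rearranged τ c) (strictlyInverseˡ i)))
      (rearranged-inverse σ τ (λ i → Perm.inverseˡ (proj₁ sorting)) c k)

    ML : ∀ x → M (L x) ≈ₚ x
    ML x u = trans (rearranged-inverse τ σ (λ i → Perm.inverseʳ (proj₁ sorting)) (x ∘ from) (to u))
                   (reflexive (≡.cong x (strictlyInverseʳ u)))

    inject₁<suc : ∀ (k : Fin n) → toℕ (inject₁ k) ℕ.< toℕ (suc k)
    inject₁<suc k = s≤s (ℕ.≤-reflexive (Fin.toℕ-inject₁ k))

    0<Lp : ∀ k → 0# < L p k
    0<Lp k = 0<y-x (sorted (inject₁<suc k))

    cell⇒L : ∀ x → Cell p x → ∀ k → 0# < L p k * L x k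
    cell⇒L x px k = separated px λ e → ℕ.<⇒≢ (inject₁<suc k) (≡.cong toℕ (σ-injective e))

    L⇒cell : ∀ x → (∀ k → 0# < L p k * L x k) → Cell p x
    L⇒cell x 0<LpLx J = on-interval (index⇒interval J)
      where
      sorted-x : ∀ {i j} → toℕ i ℕ.< toℕ j → prefixes x (σ i) < prefixes x (σ j)
      sorted-x = increasing (prefixes x ∘ σ) λ k → 0<y-x⇒x<y (0<*-cancelˡ (0<Lp k) (0<LpLx k))

      on-interval : (∃ λ a → ∃ λ b → toℕ a ℕ.< toℕ b × (∀ x → F (proj₁ J) x ≈ prefixes x b - prefixes x a)) →
                    0# < F (proj₁ J) p * F (proj₁ J) x
      on-interval (a , b , a<b , FJ) = <-respʳ (sym (*-cong (FJ p) (FJ x))) (≡.subst₂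
        (λ a b → 0# < (prefixes p b - prefixes p a) * (prefixes x b - prefixes x a))
        (Perm.inverseʳ (proj₁ sorting)) (Perm.inverseʳ (proj₁ sorting)) (co-sorted (prefixes p ∘ σ) (prefixes x ∘ σ) sorted sorted-x {τ a} {τ b} λ e →
          ℕ.<⇒≢ a<b (≡.cong toℕ (≡.trans (≡.sym (Perm.inverseʳ (proj₁ sorting))) (≡.trans (≡.cong σ e) (Perm.inverseʳ (proj₁ sorting)))))))

-- The triangle

-- `γ` holds the coefficients of a form in wall coordinates. The condition makes the form positive
-- wherever the coordinates have the signs `s`.
SameSign : ∀ {k} → (Fin k → Bool) → (Fin k → ℤ) → Set
SameSign s γ = (∀ i → + 0 ℤ.≤ signed i) × (∃ λ i → + 0 ℤ.< signed i)
  where signed = λ i → if s i then γ i else ℤ.- γ i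

sameSign? : ∀ {k} (s : Fin k → Bool) γ → Dec (SameSign s γ)
sameSign? s γ = Fin.all? (λ i → + 0 ℤ.≤? _) ×-dec Fin.any? (λ i → + 0 ℤ.<? _)

δ : ∀ {k} → Fin k → Fin k → ℤ
δ i j = ι (does (i Fin.≟ j))

-- A chamber of the triangle: the numbers of its walls in the list triangle-forms below,
-- and the basis dual to these walls.
Chamber : Set
Chamber = Vec (Fin 7) 3 × Vec (Vec ℤ 3) 3

wall : Chamber → Fin 3 → Fin 7
wall (W , _) = lookup W

dual : Chamber → Fin 3 → Fin 3 → ℤ
dual (_ , N) k = lookup (lookup N k)

triangle-forms : Fin 7 → Subset 3
triangle-forms = lookup
  ( (true ∷ false ∷ false ∷ []) ∷ (false ∷ true ∷ false ∷ []) ∷ (false ∷ false ∷ true ∷ [])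
  ∷ (true ∷ true ∷ false ∷ []) ∷ (true ∷ false ∷ true ∷ []) ∷ (false ∷ true ∷ true ∷ [])
  ∷ (true ∷ true ∷ true ∷ []) ∷ [])

-- The 32 chambers up to x ↦ − x.
chambers : List Chamber
chambers =
    (0F ∷ 1F ∷ 2F ∷ [] , (+ 1 ∷ + 0 ∷ + 0 ∷ []) ∷ (+ 0 ∷ + 1 ∷ + 0 ∷ []) ∷ (+ 0 ∷ + 0 ∷ + 1 ∷ []) ∷ [])
  ∷ (1F ∷ 2F ∷ 6F ∷ [] , (-[1+ 0 ] ∷ + 1 ∷ + 0 ∷ []) ∷ (-[1+ 0 ] ∷ + 0 ∷ + 1 ∷ []) ∷ (+ 1 ∷ + 0 ∷ + 0 ∷ []) ∷ [])
  ∷ (2F ∷ 0F ∷ 6F ∷ [] , (+ 0 ∷ -[1+ 0 ] ∷ + 1 ∷ []) ∷ (+ 1 ∷ -[1+ 0 ] ∷ + 0 ∷ []) ∷ (+ 0 ∷ + 1 ∷ + 0 ∷ []) ∷ [])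
  ∷ (0F ∷ 1F ∷ 6F ∷ [] , (+ 1 ∷ + 0 ∷ -[1+ 0 ] ∷ []) ∷ (+ 0 ∷ + 1 ∷ -[1+ 0 ] ∷ []) ∷ (+ 0 ∷ + 0 ∷ + 1 ∷ []) ∷ [])
  ∷ (3F ∷ 4F ∷ 6F ∷ [] , (+ 1 ∷ + 0 ∷ -[1+ 0 ] ∷ []) ∷ (+ 1 ∷ -[1+ 0 ] ∷ + 0 ∷ []) ∷ (-[1+ 0 ] ∷ + 1 ∷ + 1 ∷ []) ∷ [])
  ∷ (5F ∷ 3F ∷ 6F ∷ [] , (-[1+ 0 ] ∷ + 1 ∷ + 0 ∷ []) ∷ (+ 0 ∷ + 1 ∷ -[1+ 0 ] ∷ []) ∷ (+ 1 ∷ -[1+ 0 ] ∷ + 1 ∷ []) ∷ [])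
  ∷ (4F ∷ 5F ∷ 6F ∷ [] , (+ 0 ∷ -[1+ 0 ] ∷ + 1 ∷ []) ∷ (-[1+ 0 ] ∷ + 0 ∷ + 1 ∷ []) ∷ (+ 1 ∷ + 1 ∷ -[1+ 0 ] ∷ []) ∷ [])
  ∷ (4F ∷ 2F ∷ 3F ∷ [] , (+ 1 ∷ -[1+ 0 ] ∷ + 0 ∷ []) ∷ (-[1+ 0 ] ∷ + 1 ∷ + 1 ∷ []) ∷ (+ 0 ∷ + 1 ∷ + 0 ∷ []) ∷ [])
  ∷ (3F ∷ 0F ∷ 5F ∷ [] , (+ 0 ∷ + 1 ∷ -[1+ 0 ] ∷ []) ∷ (+ 1 ∷ -[1+ 0 ] ∷ + 1 ∷ []) ∷ (+ 0 ∷ + 0 ∷ + 1 ∷ []) ∷ [])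
  ∷ (5F ∷ 1F ∷ 4F ∷ [] , (-[1+ 0 ] ∷ + 0 ∷ + 1 ∷ []) ∷ (+ 1 ∷ + 1 ∷ -[1+ 0 ] ∷ []) ∷ (+ 1 ∷ + 0 ∷ + 0 ∷ []) ∷ [])
  ∷ (3F ∷ 1F ∷ 4F ∷ [] , (+ 1 ∷ + 0 ∷ -[1+ 0 ] ∷ []) ∷ (-[1+ 0 ] ∷ + 1 ∷ + 1 ∷ []) ∷ (+ 0 ∷ + 0 ∷ + 1 ∷ []) ∷ [])
  ∷ (5F ∷ 2F ∷ 3F ∷ [] , (-[1+ 0 ] ∷ + 1 ∷ + 0 ∷ []) ∷ (+ 1 ∷ -[1+ 0 ] ∷ + 1 ∷ []) ∷ (+ 1 ∷ + 0 ∷ + 0 ∷ []) ∷ [])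
  ∷ (4F ∷ 0F ∷ 5F ∷ [] , (+ 0 ∷ -[1+ 0 ] ∷ + 1 ∷ []) ∷ (+ 1 ∷ + 1 ∷ -[1+ 0 ] ∷ []) ∷ (+ 0 ∷ + 1 ∷ + 0 ∷ []) ∷ [])
  ∷ (0F ∷ 3F ∷ 4F ∷ [] , (+ 1 ∷ -[1+ 0 ] ∷ -[1+ 0 ] ∷ []) ∷ (+ 0 ∷ + 1 ∷ + 0 ∷ []) ∷ (+ 0 ∷ + 0 ∷ + 1 ∷ []) ∷ [])
  ∷ (1F ∷ 5F ∷ 3F ∷ [] , (-[1+ 0 ] ∷ + 1 ∷ -[1+ 0 ] ∷ []) ∷ (+ 0 ∷ + 0 ∷ + 1 ∷ []) ∷ (+ 1 ∷ + 0 ∷ + 0 ∷ []) ∷ [])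
  ∷ (2F ∷ 4F ∷ 5F ∷ [] , (-[1+ 0 ] ∷ -[1+ 0 ] ∷ + 1 ∷ []) ∷ (+ 1 ∷ + 0 ∷ + 0 ∷ []) ∷ (+ 0 ∷ + 1 ∷ + 0 ∷ []) ∷ [])
  ∷ []

-- The forms numbered i, j and k satisfy xᵢ + xⱼ = xₖ.
relations : List (Fin 7 × Fin 7 × Fin 7)
relations = (0F , 1F , 3F) ∷ (0F , 2F , 4F) ∷ (1F , 2F , 5F) ∷ (0F , 5F , 6F) ∷ (1F , 4F , 6F) ∷ (2F , 3F , 6F) ∷ []

Violates : Vec Bool 7 → Fin 7 × Fin 7 × Fin 7 → Set
Violates s (i , j , k) = lookup s i ≡ lookup s j × lookup s i ≢ lookup s k

coefficient : Chamber → Fin 7 → Fin 3 → ℤ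
coefficient C i k = total (triangle-forms i) (dual C k)

-- The matrices of walls and of dual vectors are inverse to each other on both sides: the first
-- equation yields L ∘ M = id, the second M ∘ L = id.
DualBases : Chamber → Set
DualBases C = (∀ l k → total (triangle-forms (wall C l)) (dual C k) ≡ δ k l) ×
              (∀ i j → total (tabulate λ k → lookup (triangle-forms (wall C k)) i) (λ k → dual C k j) ≡ δ i j)

-- On the cone cut out by the walls of C with signs s, each form has constant sign.
Determines : Vec Bool 7 → Chamber → Set
Determines s C = DualBases C × (∀ i →
  SameSign (lookup s ∘ wall C) (coefficient C i) ⊎ SameSign (lookup s ∘ wall C) (ℤ.-_ ∘ coefficient C i))

classified? : ∀ s → Dec (Any (Violates s) relations ⊎ Any (Determines s) chambers)
classified? s = Any.any? violates? relations ⊎-dec Any.any? determines? chambers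
  where
  violates? : ∀ r → Dec (Violates s r)
  violates? (i , j , k) = (lookup s i Bool.≟ lookup s j) ×-dec ¬? (lookup s i Bool.≟ lookup s k)
  determines? : ∀ C → Dec (Determines s C)
  determines? C =
    (Fin.all? (λ l → Fin.all? λ k → _ ℤ.≟ _) ×-dec Fin.all? (λ i → Fin.all? λ j → _ ℤ.≟ _))
    ×-dec Fin.all? (λ i → sameSign? (lookup s ∘ wall C) (coefficient C i) ⊎-dec sameSign? (lookup s ∘ wall C) (ℤ.-_ ∘ coefficient C i))

abstract
  -- A search through the 128 sign vectors of the seven forms. The signs of the walls are read from
  -- `s`, so one entry of `chambers` serves a sign vector and its negative; `abstract` prevents the
  -- search from being unfolded later.
  classification : ∀ s → Any (Violates s) relations ⊎ Any (Determines s) chambers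
  classification s = decidable-stable (classified? s) λ ¬c →
    toWitnessFalse {a? = anySubset? (λ s → ¬? (classified? s))} _ (s , ¬c)

module TriangleArrangement (em : ExcludedMiddle 0ℓ) (ℝ : CompleteOrderedField) (G : Graph (Fin 3))
  (iso : G ≅ triangle) where
  open OrderedField ℝ
  open Topology em ℝ
  open SimplicialCones em ℝ
  open GenericPoints em ℝ
  open Quadrilaterals em ℝ G
  open SemiringSum semiring using (sum; sum-cong-≋; *-distribˡ-sum)

  all-connected : ∀ (I : Subset 3) → Nonempty I → Connected (G [ I ])
  all-connected I base = base , λ u v → walk u v
    where
    open Inverse (_≅_.vertices iso) using (from; strictlyInverseʳ)
    walk : ∀ u v → Star (Adj (G [ I ])) u v
    walk (u , u∈) (v , v∈) with u Fin.≟ v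
    ... | yes ≡.refl with ≡.refl ← []=-irrelevant u∈ v∈ = ε
    ... | no  u≢v = Equivalence.from (_≅_.adjacent iso u v) (λ e → u≢v
      (≡.trans (≡.sym (strictlyInverseʳ u)) (≡.trans (≡.cong from e) (strictlyInverseʳ v)))) ◅ ε

  index : Fin 7 → Index
  index i = triangle-forms i , nonempty i , all-connected (triangle-forms i) (nonempty i)
    where
    nonempty : ∀ i → Nonempty (triangle-forms i)
    nonempty 0F = 0F , Vec.here
    nonempty 1F = 1F , Vec.there Vec.here
    nonempty 2F = 2F , Vec.there (Vec.there Vec.here)
    nonempty 3F = 0F , Vec.here
    nonempty 4F = 0F , Vec.here
    nonempty 5F = 1F , Vec.there Vec.here
    nonempty 6F = 0F , Vec.here

  form-number : ∀ (I : Subset 3) → Nonempty I → ∃ λ i → I ≡ triangle-forms i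
  form-number (true  ∷ false ∷ false ∷ []) _ = 0F , ≡.refl
  form-number (false ∷ true  ∷ false ∷ []) _ = 1F , ≡.refl
  form-number (false ∷ false ∷ true  ∷ []) _ = 2F , ≡.refl
  form-number (true  ∷ true  ∷ false ∷ []) _ = 3F , ≡.refl
  form-number (true  ∷ false ∷ true  ∷ []) _ = 4F , ≡.refl
  form-number (false ∷ true  ∷ true  ∷ []) _ = 5F , ≡.refl
  form-number (true  ∷ true  ∷ true  ∷ []) _ = 6F , ≡.refl
  form-number (false ∷ false ∷ false ∷ []) (_ , Vec.there (Vec.there (Vec.there ())))

  form : Fin 7 → Point ℝ 3 → Carrier
  form i = F (triangle-forms i)

  form-relations : All (λ (i , j , k) → ∀ x → form i x + form j x ≈ form k x) relations
  form-relations =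
    -- The polynomials reproduce the unfolded sums, with a zero for each omitted coordinate and one
    -- at the end.
    (λ x → solve 3 (λ a b c → (a :+ (:0 :+ (:0 :+ :0))) :+ (:0 :+ (b :+ (:0 :+ :0))) := a :+ (b :+ (:0 :+ :0))) refl (x 0F) (x 1F) (x 2F)) All.∷
    (λ x → solve 3 (λ a b c → (a :+ (:0 :+ (:0 :+ :0))) :+ (:0 :+ (:0 :+ (c :+ :0))) := a :+ (:0 :+ (c :+ :0))) refl (x 0F) (x 1F) (x 2F)) All.∷
    (λ x → solve 3 (λ a b c → (:0 :+ (b :+ (:0 :+ :0))) :+ (:0 :+ (:0 :+ (c :+ :0))) := :0 :+ (b :+ (c :+ :0))) refl (x 0F) (x 1F) (x 2F)) All.∷
    (λ x → solve 3 (λ a b c → (a :+ (:0 :+ (:0 :+ :0))) :+ (:0 :+ (b :+ (c :+ :0))) := a :+ (b :+ (c :+ :0))) refl (x 0F) (x 1F) (x 2F)) All.∷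
    (λ x → solve 3 (λ a b c → (:0 :+ (b :+ (:0 :+ :0))) :+ (a :+ (:0 :+ (c :+ :0))) := a :+ (b :+ (c :+ :0))) refl (x 0F) (x 1F) (x 2F)) All.∷
    (λ x → solve 3 (λ a b c → (:0 :+ (:0 :+ (c :+ :0))) :+ (a :+ (b :+ (:0 :+ :0))) := a :+ (b :+ (c :+ :0))) refl (x 0F) (x 1F) (x 2F)) All.∷ All.[]

  fromℤ-δ : ∀ {k} (i j : Fin k) → fromℤ (δ i j) ≈ unit i j
  fromℤ-δ zero    zero    = refl
  fromℤ-δ zero    (suc _) = refl
  fromℤ-δ (suc _) zero    = refl
  fromℤ-δ (suc i) (suc j) = fromℤ-δ i j

  F-integral : ∀ {n} (I : Subset n) α → F I (fromℤ ∘ α) ≈ fromℤ (total I α)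
  F-integral I α = trans (sum-cong-≋ λ i → if≈*bit (lookup I i) (fromℤ (α i))) (total-sum I α)
    where
    if≈*bit : ∀ b z → (if b then z else 0#) ≈ z * bit b
    if≈*bit true  z = sym (*-identityʳ z)
    if≈*bit false z = sym (zeroʳ z)

  sum-pos : ∀ {k} (f : Fin k → Carrier) → (∀ i → 0# ≤ f i) → (∃ λ i → 0# < f i) → 0# < sum f
  sum-pos f 0≤f (zero  , 0<f) = 0<+≤ 0<f (sum-nonneg (f ∘ suc) (0≤f ∘ suc))
  sum-pos f 0≤f (suc i , 0<f) = <-respʳ (+-comm _ _) (0<+≤ (sum-pos (f ∘ suc) (0≤f ∘ suc) (i , 0<f)) (0≤f zero))

  HasSign : Bool → Carrier → Set
  HasSign b x = 0# < (if b then x else - x)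

  hasSign-product : ∀ b {x y} → HasSign b x → HasSign b y → 0# < x * y
  hasSign-product true          0<x  0<y  = *-pos 0<x 0<y
  hasSign-product false {x} {y} 0<-x 0<-y =
    <-respʳ (solve 2 (λ x y → (:- x) :* (:- y) := x :* y) refl x y) (*-pos 0<-x 0<-y)

  hasSign-transfer : ∀ b {x y} → HasSign b x → 0# < x * y → HasSign b y
  hasSign-transfer true          0<x  0<xy = 0<*-cancelˡ 0<x 0<xy
  hasSign-transfer false {x} {y} 0<-x 0<xy =
    0<*-cancelˡ 0<-x (<-respʳ (solve 2 (λ x y → x :* y := (:- x) :* (:- y)) refl x y) 0<xy)

  hasSign-+ : ∀ b {x y} → HasSign b x → HasSign b y → HasSign b (x + y)
  hasSign-+ true          = 0<+
  hasSign-+ false {x} {y} 0<-x 0<-y = <-respʳ (solve 2 (λ x y → :- x :+ :- y := :- (x :+ y)) refl x y) (0<+ 0<-x 0<-y)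

  hasSign-unique : ∀ b c {x} → HasSign b x → HasSign c x → b ≡ c
  hasSign-unique true  true  _ _ = ≡.refl
  hasSign-unique false false _ _ = ≡.refl
  hasSign-unique true  false {x} 0<x 0<-x = contradiction (0<+ 0<x 0<-x) (<-irrefl (sym (-‿inverseʳ x)))
  hasSign-unique false true  {x} 0<-x 0<x = contradiction (0<+ 0<x 0<-x) (<-irrefl (sym (-‿inverseʳ x)))

  hasSign-resp : ∀ b {x y} → x ≈ y → HasSign b x → HasSign b y
  hasSign-resp true  x≈y = <-respʳ x≈y
  hasSign-resp false x≈y = <-respʳ (-‿cong x≈y)

  nonzero-sign : ∀ {x} → ¬ x ≈ 0# → ∃ λ b → HasSign b x
  nonzero-sign {x} x≉0 with compare 0# x
  ... | tri< 0<x _ _ = true , 0<x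
  ... | tri≈ _ 0≈x _ = contradiction (sym 0≈x) x≉0
  ... | tri> _ _ x<0 = false , <0⇒0<- x<0

  sameSign-sum : ∀ {k} (s : Fin k → Bool) γ (t : Fin k → Carrier) → (∀ i → HasSign (s i) (t i)) →
                 SameSign s γ → 0# < sum (λ i → t i * fromℤ (γ i))
  sameSign-sum s γ t signs (nonneg , i , pos) = sum-pos _
    (λ i → ≤-respʳ (sym (signed (s i) (t i) (γ i))) (0≤* (inj₁ (signs i)) (fromℤ-nonneg (nonneg i))))
    (i , <-respʳ (sym (signed (s i) (t i) (γ i))) (*-pos (signs i) (fromℤ-pos pos)))
    where
    signed : ∀ b t c → t * fromℤ c ≈ (if b then t else - t) * fromℤ (if b then c else ℤ.- c)
    signed true  t c = refl
    signed false t c = trans (solve 2 (λ t c → t :* c := (:- t) :* (:- c)) refl t (fromℤ c)) (*-congˡ (sym (fromℤ-neg c)))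

  module _ (p : Point ℝ 3) (p∉ : Complement p) where

    sign : Fin 7 → Bool
    sign i = proj₁ (nonzero-sign λ e → p∉ (index i , e))

    hasSign : ∀ i → HasSign (sign i) (form i p)
    hasSign i = proj₂ (nonzero-sign λ e → p∉ (index i , e))

    signs : Vec Bool 7
    signs = tabulate sign

    consistent : ¬ Any (Violates signs) relations
    consistent violated = All.lookupWith (λ {r} → refute {r}) form-relations violated
      where
      refute : ∀ {r@(i , j , k) : Fin 7 × Fin 7 × Fin 7} → (∀ x → form i x + form j x ≈ form k x) → ¬ Violates signs r
      refute {i , j , k} rel (sᵢ≡sⱼ , sᵢ≢sₖ)
        rewrite lookup∘tabulate sign i | lookup∘tabulate sign j | lookup∘tabulate sign k =
        sᵢ≢sₖ (hasSign-unique (sign i) (sign k)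
          (hasSign-resp (sign i) (rel p) (hasSign-+ (sign i) (hasSign i) (≡.subst (λ b → HasSign b (form j p)) (≡.sym sᵢ≡sⱼ) (hasSign j))))
          (hasSign k))

    module _ (C : Chamber) (bases : DualBases C) where

      v : Fin 3 → Point ℝ 3
      v k = fromℤ ∘ dual C k

      L M : Point ℝ 3 → Point ℝ 3
      L x k = form (wall C k) x
      M c   = combination ℝ c v

      form∘M : ∀ i c → form i (M c) ≈ sum (λ k → c k * fromℤ (coefficient C i k))
      form∘M i c = trans (combination-homo (coordinateSum-linear (triangle-forms i)) c v)
        (sum-cong-≋ λ k → *-congˡ {c k} (F-integral (triangle-forms i) (dual C k)))

      LM : ∀ c → L (M c) ≈ₚ c
      LM c l = trans (form∘M (wall C l) c) (trans
        (sum-cong-≋ λ k → *-congˡ {c k} (trans (reflexive (≡.cong fromℤ (proj₁ bases l k))) (fromℤ-δ k l)))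
        (unit-expansion c l))

      ML-linear : ∀ j → IsLinearForm (λ x → M (L x) j)
      ML-linear j = record
        { cong    = λ x≈y → IsLinearForm.cong (combination-linear v j) λ k → cong (triangle-forms (wall C k)) x≈y
        ; +*-homo = λ x t y → trans
            (IsLinearForm.cong (combination-linear v j) λ k → +*-homo (triangle-forms (wall C k)) x t y)
            (IsLinearForm.+*-homo (combination-linear v j) (L x) t (L y))
        }

      -- M ∘ L is linear, so unit vectors suffice, and for them this is the second equation of
      -- `DualBases`.
      ML : ∀ x → M (L x) ≈ₚ x
      ML x j = trans (linear-expansion (ML-linear j) x) (trans (sum-cong-≋ λ i → *-congˡ {x i} (on-unit i)) (unit-expansion x j))
        where
        on-unit : ∀ i → M (L (unit i)) j ≈ unit i j
        on-unit i = trans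
          (sum-cong-≋ λ k → trans
            (*-congʳ {fromℤ (dual C k j)} (trans (F-unit (triangle-forms (wall C k)) i)
              (reflexive (≡.cong bit (≡.sym (lookup∘tabulate (λ k → lookup (triangle-forms (wall C k)) i) k))))))
            (*-comm (bit (lookup (tabulate λ k → lookup (triangle-forms (wall C k)) i) k)) (fromℤ (dual C k j))))
          (trans (total-sum (tabulate λ k → lookup (triangle-forms (wall C k)) i) (λ k → dual C k j))
            (trans (reflexive (≡.cong fromℤ (proj₂ bases i j))) (fromℤ-δ i j)))

      chamber-simplicial : Determines signs C → IsOpenSimplicialCone ℝ (Cell p)
      chamber-simplicial (_ , same) = coordinates⇒simplicial L M
        (λ x≈y k → cong (triangle-forms (wall C k)) x≈y) (combination-linear v) LM ML p
        (λ k e → p∉ (index (wall C k) , e)) λ x → mk⇔ (λ px k → px (index (wall C k))) (L⇒cell x)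
        where
        wall-signs : ∀ x → (∀ k → 0# < L p k * L x k) → ∀ k → HasSign (lookup signs (wall C k)) (L x k)
        wall-signs x LpLx k rewrite lookup∘tabulate sign (wall C k) =
          hasSign-transfer (sign (wall C k)) (hasSign (wall C k)) (LpLx k)

        expand : ∀ i x → form i x ≈ sum (λ k → L x k * fromℤ (coefficient C i k))
        expand i x = trans (cong (triangle-forms i) λ j → sym (ML x j)) (form∘M i (L x))

        -- The sign depends on the walls alone, so it is common to `p` and every `x` on the same
        -- sides of them.
        form-sign : ∀ i → ∃ λ b → ∀ x → (∀ k → 0# < L p k * L x k) → HasSign b (form i x)
        form-sign i with same i
        ... | inj₁ pos = true , λ x LpLx → <-respʳ (sym (expand i x)) (sameSign-sum _ _ (L x) (wall-signs x LpLx) pos)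
        ... | inj₂ neg = false , λ x LpLx → <-respʳ (trans (negate x) (-‿cong (sym (expand i x)))) (sameSign-sum _ _ (L x) (wall-signs x LpLx) neg)
          where
          negate : ∀ x → sum (λ k → L x k * fromℤ (ℤ.- coefficient C i k)) ≈ - sum (λ k → L x k * fromℤ (coefficient C i k))
          negate x = trans
            (sum-cong-≋ λ k → trans (*-congˡ {L x k} (fromℤ-neg (coefficient C i k)))
              (solve 2 (λ t c → t :* (:- c) := (:- :1) :* (t :* c)) refl (L x k) (fromℤ (coefficient C i k))))
            (trans (sym (*-distribˡ-sum (- 1#) (λ k → L x k * fromℤ (coefficient C i k))))
              (solve 1 (λ a → (:- :1) :* a := :- a) refl _))

        L⇒cell : ∀ x → (∀ k → 0# < L p k * L x k) → Cell p x
        L⇒cell x LpLx (I , nonempty , _) with i , ≡.refl ← form-number I nonempty =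
          hasSign-product (proj₁ (form-sign i))
            (proj₂ (form-sign i) p (λ k → self-in-cell {p} p∉ (index (wall C k)))) (proj₂ (form-sign i) x LpLx)

  triangle-simplicial : AllSimplicial
  triangle-simplicial p p∉ =
    [ (λ violated → contradiction violated (consistent p p∉))
    , (λ determined → let (C , det) = Any.satisfied determined in chamber-simplicial p p∉ C (proj₁ det) det) ]′
    (classification (signs p p∉))

theorem7p2 : (∀ {ℓ} → ExcludedMiddle ℓ) →
    (ℝ : CompleteOrderedField) →
    (n : ℕ) (G : Graph (Fin n)) → Connected G →
    Simplicial ℝ (connectedSubgraphArrangement ℝ G) ⇔ (IsTriangle G ⊎ IsPath G)
theorem7p2 em ℝ n G G-connected = mk⇔
  (λ simplicial →
    let cells = Equivalence.to simplicial⇔cells simplicial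
    in triangle-or-path
      (λ vu₁ vu₂ vu₃ u₁≢u₂ u₁≢u₃ u₂≢u₃ ¬u₁u₂ → claw⇒¬simplicial vu₁ vu₂ vu₃ u₁≢u₂ u₁≢u₃ u₂≢u₃ ¬u₁u₂ cells)
      (λ m P P-injective consecutive closing → cycle⇒¬simplicial m P P-injective consecutive closing cells))
  (λ triangle-or-path → Equivalence.from simplicial⇔cells (Sum.[ from-triangle G , from-path G ]′ triangle-or-path))
  where
  open Quadrilaterals em ℝ G using (simplicial⇔cells)
  open Obstructions em ℝ G using (cycle⇒¬simplicial; claw⇒¬simplicial)
  open LongestPaths em G G-connected using (triangle-or-path)

  -- `n` is quantified anew so that the equation `n ≡ 3` between the numbers of vertices can be
  -- matched with `refl`.
  from-triangle : ∀ {n} (G : Graph (Fin n)) → IsTriangle G → Quadrilaterals.AllSimplicial em ℝ G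
  from-triangle G iso with ≡.refl ← ↔⇒≡ (_≅_.vertices iso) = TriangleArrangement.triangle-simplicial em ℝ G iso

  from-path : ∀ {n} (G : Graph (Fin n)) → IsPath G → Quadrilaterals.AllSimplicial em ℝ G
  from-path G (m , iso) with ≡.refl ← ↔⇒≡ (_≅_.vertices iso) = PathArrangement.path-simplicial em ℝ G iso
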